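{- For any $n$-vertex undirected unweighted graph $G=(V,E)$ and nonnegative integer $f$, there is an $(f+1)$-FT $+4$ additive spanner of $G$ with $O_f\left(n^{1+2^f/(2^f+1)}\right)$ edges.
   Context: For an integer $k\ge 0$, a subgraph $H\subseteq G$ is a $k$-FT $+4$ additive spanner of $G$ if $\mathrm{dist}_{H\setminus F}(s,t)\le \mathrm{dist}_{G\setminus F}(s,t)+4$ for all vertices $s,t\in V$ and every edge set $F\subseteq E$ with $|F|\le k$. $O_f$ means the hidden constant may depend on $f$. -}

module Defs where

open import Data.Nat using (ℕ; zero; suc; _+_; _≤_; _<ᵇ_)
open import Data.Bool using (Bool; true; false; _∧_; not; _∨_)
open import Data.Fin using (Fin; toℕ; _≟_)
open import Data.List using (List; length; filter; allFin; cartesianProduct)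
open import Data.Bool.ListAction using (any)
open import Data.Product using (_×_; _,_; ∃-syntax)
open import Relation.Binary.PropositionalEquality using (_≡_)
open import Relation.Nullary.Decidable using (⌊_⌋)
open import Relation.Nullary using (Dec; yes; no)

record Graph (n : ℕ) : Set where
  field
    adj    : Fin n → Fin n → Bool
    sym    : ∀ u v → adj u v ≡ adj v u
    irrefl : ∀ u → adj u u ≡ false
open Graph public

_⊆ᴳ_ : ∀ {n} → Graph n → Graph n → Set
H ⊆ᴳ G = ∀ u v → adj H u v ≡ true → adj G u v ≡ true

numEdges : ∀ {n} → Graph n → ℕ
numEdges {n} G =
  length (filter (λ p → Data.Bool._≟_ ((toℕ (proj₁' p) <ᵇ toℕ (proj₂' p)) ∧ adj G (proj₁' p) (proj₂' p)) true)
                 (cartesianProduct (allFin n) (allFin n)))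
  where
  proj₁' : Fin n × Fin n → Fin n
  proj₁' (a , _) = a
  proj₂' : Fin n × Fin n → Fin n
  proj₂' (_ , b) = b

FaultSet : ℕ → Set
FaultSet n = List (Fin n × Fin n)

inFaults : ∀ {n} → FaultSet n → Fin n → Fin n → Bool
inFaults F u v = any (λ { (a , b) → (⌊ a ≟ u ⌋ ∧ ⌊ b ≟ v ⌋) ∨ (⌊ a ≟ v ⌋ ∧ ⌊ b ≟ u ⌋) }) F

adjMinus : ∀ {n} → Graph n → FaultSet n → Fin n → Fin n → Bool
adjMinus G F u v = adj G u v ∧ not (inFaults F u v)

data Walk {n : ℕ} (A : Fin n → Fin n → Bool) : Fin n → Fin n → ℕ → Set where
  here : ∀ {s} → Walk A s s 0
  step : ∀ {s u t ℓ} → A s u ≡ true → Walk A u t ℓ → Walk A s t (suc ℓ)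

-- dist_A(s,t) ≤ d  (with dist = ∞ if t is unreachable from s).
DistLe : ∀ {n} → (Fin n → Fin n → Bool) → Fin n → Fin n → ℕ → Set
DistLe A s t d = ∃[ ℓ ] (ℓ ≤ d × Walk A s t ℓ)

FTAdditiveSpanner : ∀ {n} → ℕ → ℕ → Graph n → Graph n → Set
FTAdditiveSpanner {n} k β G H =
  H ⊆ᴳ G ×
  (∀ (F : FaultSet n) → (∀ u v → inFaults F u v ≡ true → adj G u v ≡ true) → length F ≤ k →
   ∀ s t d → DistLe (adjMinus G F) s t d → DistLe (adjMinus H F) s t (d + β))

{-# OPTIONS --safe #-}
-- Arcs get weights w(u,v) = M + p(u,v) − p(v,u) with generic tiny p, so that shortest paths are unique and
-- w(u,v) + w(v,u) = 2M. This antisymmetry yields restoration: a shortest s–t path avoiding F ∪ {e} may be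
-- replaced by two minimal paths x→s and x→t of G ∖ F, both avoiding e. Hence the minimal paths into a set S
-- under at most f faults preserve S × S distances under f + 1 faults.
-- The minimal paths leaving a vertex v use few first arcs: insert the faults one at a time. With m = 2^f + 1 and
-- x ≈ n^(1/m), either the faults can be matched with distinct radii x^(2^j), j < f, exceeding their distances
-- from v, and there are few choices; or for some j all but j faults are farther than x^(2^j), the first arc
-- depends only on the other j faults and on any of the first x^(2^j) vertices of the path, and a small sample of
-- vertices serves half of such arcs.
-- Finally S is chosen greedily so that, up to few edges, every vertex has f + 2 neighbours in S; one of them
-- survives f + 1 faults, and routing through such neighbours costs the additive 4.
module Submission where

open import Defs hiding (sym)
open import Data.Nat hiding (_≟_)
open import Data.Nat.Properties hiding (_≟_)
open import Data.Nat.DivMod using (_%_; [m+kn]%n≡m%n; m<n⇒m%n≡m)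
open import Data.Nat.Induction using (<-wellFounded)
open import Data.Nat.ListAction using (sum; product)
open import Data.Nat.ListAction.Properties using (sum-++)
open import Data.Nat.Tactic.RingSolver using (solve-∀)
open import Data.Bool as Bool using (Bool; true; false; _∧_; _∨_; if_then_else_)
open import Data.Bool.ListAction using (any)
open import Data.Bool.Properties using (∨-comm; ¬-not)
open import Data.Empty using (⊥; ⊥-elim)
open import Data.Fin using (Fin; zero; suc; toℕ; combine; _≟_)
open import Data.Fin.Properties using (any?; toℕ<n; toℕ-injective; combine-injective)
open import Data.List hiding (product; sum; any; find; _∷ʳ_)
open import Data.List.Properties
  using (∷-injective; ++-assoc; map-++; length-++; length-map; length-take; length-tabulate;
         length-upTo; length-downFrom; length-removeAt′; take-all)
open import Data.List.Membership.Propositional using (_∈_; _∉_; find; lose)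
open import Data.List.Membership.Propositional.Properties
open import Data.List.Relation.Unary.All as All using (All; []; _∷_)
import Data.List.Relation.Unary.All.Properties as All
open import Data.List.Relation.Unary.AllPairs using ([]; _∷_)
import Data.List.Relation.Unary.AllPairs.Properties as AllPairs
open import Data.List.Relation.Unary.Any as Any using (Any; here; there)
open import Data.List.Relation.Unary.Unique.Propositional using (Unique)
import Data.List.Relation.Unary.Unique.Propositional.Properties as Unique
open import Data.List.Relation.Binary.Sublist.Propositional
  using (_⊆_; []; _∷_; _∷ʳ_) renaming (lookup to ⊆-lookup)
open import Data.List.Relation.Binary.Sublist.Propositional.Properties using (All-resp-⊆; take-⊆)
open import Data.Product using (_×_; _,_; ∃; ∃₂; ∃-syntax; proj₁; proj₂)
open import Data.Sum using (_⊎_; inj₁; inj₂)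
open import Function using (_∘_; case_of_)
open import Induction.WellFounded using (Acc; acc)
open import Relation.Nullary using (yes; no; ¬_; Dec; ⌊_⌋)
open import Relation.Nullary.Decidable using (_×-dec_; _⊎-dec_; map′; ¬?)
open import Relation.Binary.PropositionalEquality

-- The exponents 2^j come from balancing. The radii x^(2^j), j < g, multiply to x^(2^g - 1), so O(n
-- / x^(2^g)) targets leave only O(n / x) choices of a first arc when all faults are matched. A
-- sample meeting sets of x^(2^j) vertices has O(n / x^(2^j)) members, which is exactly the density
-- of targets at which the count for j faults gives O(n / x) again; so every level costs the same.
-- The greedy set S has the density for g = f, and a vertex outside S has fewer than x^(2^f) light
-- edges, at most n / x because x^m ≤ n. Every vertex thus pays for O(n / x) edges, and n^2 / x =
-- O(n^(2 - 1/m)) with 2 - 1/m = 1 + 2^f / m. Restoration is what lowers the number of faults in the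
-- count from f + 1 to f; without it the exponent would contain 2^(f+1).

-- Counting

module _ {A : Set} where

  Unique-resp-⊆ : {xs ys : List A} → xs ⊆ ys → Unique ys → Unique xs
  Unique-resp-⊆ []          []       = []
  Unique-resp-⊆ (_ ∷ʳ p)    (_ ∷ u)  = Unique-resp-⊆ p u
  Unique-resp-⊆ (refl ∷ p)  (x ∷ u)  = All-resp-⊆ p x ∷ Unique-resp-⊆ p u

  ∈-++-remove : ∀ {x y : A} as {bs} → x ≢ y → y ∈ as ++ x ∷ bs → y ∈ as ++ bs
  ∈-++-remove []       x≢y (here refl) = ⊥-elim (x≢y refl)
  ∈-++-remove []       x≢y (there m)   = m
  ∈-++-remove (a ∷ as) x≢y (here p)    = here p
  ∈-++-remove (a ∷ as) x≢y (there m)   = there (∈-++-remove as x≢y m)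

  length-insert : ∀ (x : A) as {bs} → length (as ++ x ∷ bs) ≡ suc (length (as ++ bs))
  length-insert x []       = refl
  length-insert x (a ∷ as) = cong suc (length-insert x as)

  Unique⇒length≤ : ∀ {xs ys : List A} → Unique xs → (∀ {z} → z ∈ xs → z ∈ ys) → length xs ≤ length ys
  Unique⇒length≤ {[]}     _        _   = z≤n
  Unique⇒length≤ {x ∷ xs} (x∉ ∷ u) sub with ∈-∃++ (sub (here refl))
  ... | as , bs , refl = subst (suc (length xs) ≤_) (sym (length-insert x as))
        (s≤s (Unique⇒length≤ u λ z∈ → ∈-++-remove as (All.lookup x∉ z∈) (sub (there z∈))))

-- At most N / x elements satisfy P.
AtMost : {A : Set} → (A → Set) → ℕ → ℕ → Set
AtMost P x N = ∀ xs → Unique xs → All P xs → length xs * x ≤ N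

module _ {A : Set} where

  AtMost-≤ : ∀ {P : A → Set} {x M N} → M ≤ N → AtMost P x M → AtMost P x N
  AtMost-≤ M≤N h xs u p = ≤-trans (h xs u p) M≤N

  AtMost-⇒ : ∀ {P Q : A → Set} {x N} → (∀ {a} → P a → Q a) → AtMost Q x N → AtMost P x N
  AtMost-⇒ f h xs u p = h xs u (All.map f p)

  AtMost-scale : ∀ {P : A → Set} {N} x → AtMost P 1 N → AtMost P x (N * x)
  AtMost-scale x h xs u p = *-monoˡ-≤ x (≤-trans (≤-reflexive (sym (*-identityʳ (length xs)))) (h xs u p))

  AtMost-∈ : ∀ (ys : List A) → AtMost (_∈ ys) 1 (length ys)
  AtMost-∈ ys xs u p = ≤-trans (≤-reflexive (*-identityʳ _)) (Unique⇒length≤ u (All.lookup p))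

  AtMost-unique : ∀ {P : A → Set} → (∀ {a b} → P a → P b → a ≡ b) → AtMost P 1 1
  AtMost-unique f []            _                _            = z≤n
  AtMost-unique f (_ ∷ [])      _                _            = s≤s z≤n
  AtMost-unique f (_ ∷ _ ∷ _)   ((a≢b ∷ _) ∷ _)  (p ∷ q ∷ _)  = ⊥-elim (a≢b (f p q))

  All-⊎-split : ∀ {P Q : A → Set} {xs} → All (λ a → P a ⊎ Q a) xs →
                ∃₂ λ ys zs → ys ⊆ xs × zs ⊆ xs × All P ys × All Q zs × length xs ≡ length ys + length zs
  All-⊎-split [] = [] , [] , [] , [] , [] , [] , refl
  All-⊎-split {xs = x ∷ _} (h ∷ hs) with h | All-⊎-split hs
  ... | inj₁ p | ys , zs , s , t , ps , qs , eq =
        x ∷ ys , zs , refl ∷ s , x ∷ʳ t , p ∷ ps , qs , cong suc eq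
  ... | inj₂ q | ys , zs , s , t , ps , qs , eq =
        ys , x ∷ zs , x ∷ʳ s , refl ∷ t , ps , q ∷ qs , trans (cong suc eq) (sym (+-suc _ _))

  AtMost-⊎ : ∀ {P Q : A → Set} {x M N} → AtMost P x M → AtMost Q x N →
             AtMost (λ a → P a ⊎ Q a) x (M + N)
  AtMost-⊎ {x = x} hP hQ xs u h with All-⊎-split h
  ... | ys , zs , s , t , ps , qs , eq = subst (λ k → k * x ≤ _) (sym eq)
        (≤-trans (≤-reflexive (*-distribʳ-+ x (length ys) (length zs)))
          (+-mono-≤ (hP ys (Unique-resp-⊆ s u) ps) (hQ zs (Unique-resp-⊆ t u) qs)))

  AtMost-⋃ : ∀ {I : Set} {P : I → A → Set} {x N} (is : List I) → (∀ i → i ∈ is → AtMost (P i) x N) →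
             AtMost (λ a → ∃[ i ] (i ∈ is × P i a)) x (length is * N)
  AtMost-⋃ []       h []      _ _ = z≤n
  AtMost-⋃ []       h (_ ∷ _) _ ((_ , () , _) ∷ _)
  AtMost-⋃ {P = P} (i ∷ is) h = AtMost-⇒ cases (AtMost-⊎ (h i (here refl)) (AtMost-⋃ is λ j → h j ∘ there))
    where
    cases : ∀ {a} → ∃[ j ] (j ∈ i ∷ is × P j a) → P i a ⊎ ∃[ j ] (j ∈ is × P j a)
    cases (_ , here refl , p) = inj₁ p
    cases (j , there m   , p) = inj₂ (j , m , p)

  -- For an index that is determined but not listed: the first element's index serves all others. It
  -- is applied to the arc at a given position of a minimal path.
  AtMost-functional : ∀ {I : Set} {D : I → Set} {P : I → A → Set} {x N} →
                      (∀ {i j} → D i → D j → i ≡ j) → (∀ i → D i → AtMost (P i) x N) →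
                      AtMost (λ a → ∃[ i ] (D i × P i a)) x N
  AtMost-functional f h []       _ _ = z≤n
  AtMost-functional {P = P} f h (x ∷ xs) u ps@((i , d , _) ∷ _) =
    h i d (x ∷ xs) u (All.map (λ { (j , d′ , p) → subst (λ k → P k _) (f d′ d) p }) ps)

  AtMost-injection : ∀ {B : Set} {P : A → Set} {Q : B → Set} {x N} (f : B → A) →
                     (∀ {p q} → Q p → Q q → f p ≡ f q → p ≡ q) → (∀ {p} → Q p → P (f p)) →
                     AtMost P x N → AtMost Q x N
  AtMost-injection {B} {P} {Q} {x} f inj Q⇒P h xs u qs =
    subst (λ k → k * x ≤ _) (length-map f xs) (h (map f xs) (distinct u qs) (All.map⁺ (All.map Q⇒P qs)))
    where
    distinct : ∀ {ys} → Unique ys → All Q ys → Unique (map f ys)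
    distinct []       []       = []
    distinct (n ∷ ns) (q ∷ qs) =
      All.map⁺ (All.zipWith (λ (y≢z , q′) eq → y≢z (inj q q′ eq)) (n , qs)) ∷ distinct ns qs

-- Finite sums and greedy covers

𝟙 : Bool → ℕ
𝟙 b = if b then 1 else 0

module _ {A : Set} where

  ∑ : (A → ℕ) → List A → ℕ
  ∑ f xs = sum (map f xs)

  ∑-cong : ∀ {f g : A → ℕ} → (∀ a → f a ≡ g a) → ∀ xs → ∑ f xs ≡ ∑ g xs
  ∑-cong f≡g []       = refl
  ∑-cong f≡g (x ∷ xs) = cong₂ _+_ (f≡g x) (∑-cong f≡g xs)

  ∑-mono : ∀ {f g : A → ℕ} xs → (∀ {a} → a ∈ xs → f a ≤ g a) → ∑ f xs ≤ ∑ g xs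
  ∑-mono []       f≤g = z≤n
  ∑-mono (x ∷ xs) f≤g = +-mono-≤ (f≤g (here refl)) (∑-mono xs (f≤g ∘ there))

  ∑-+ : ∀ (f g : A → ℕ) xs → ∑ (λ a → f a + g a) xs ≡ ∑ f xs + ∑ g xs
  ∑-+ f g []       = refl
  ∑-+ f g (x ∷ xs) = trans (cong (f x + g x +_) (∑-+ f g xs)) (+-interchange (f x) (g x) _ _)
    where
    +-interchange : ∀ a b c d → a + b + (c + d) ≡ a + c + (b + d)
    +-interchange = solve-∀

  ∑-const : ∀ c (xs : List A) → ∑ (λ _ → c) xs ≡ length xs * c
  ∑-const c []       = refl
  ∑-const c (x ∷ xs) = cong (c +_) (∑-const c xs)

  ∑-* : ∀ c (f : A → ℕ) xs → ∑ (λ a → c * f a) xs ≡ c * ∑ f xs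
  ∑-* c f []       = sym (*-zeroʳ c)
  ∑-* c f (x ∷ xs) = trans (cong (c * f x +_) (∑-* c f xs)) (sym (*-distribˡ-+ c (f x) _))

  countᵇ : (A → Bool) → List A → ℕ
  countᵇ p = ∑ (𝟙 ∘ p)

  filterTrue : (A → Bool) → List A → List A
  filterTrue p = filter (λ a → p a Bool.≟ true)

  length-filterTrue : ∀ (p : A → Bool) xs → length (filterTrue p xs) ≡ countᵇ p xs
  length-filterTrue p []       = refl
  length-filterTrue p (x ∷ xs) with p x
  ... | true  = cong suc (length-filterTrue p xs)
  ... | false = length-filterTrue p xs

∑-swap : ∀ {A B : Set} (f : A → B → ℕ) xs ys →
         ∑ (λ a → ∑ (f a) ys) xs ≡ ∑ (λ b → ∑ (λ a → f a b) xs) ys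
∑-swap f []       ys = sym (trans (∑-const 0 ys) (*-zeroʳ (length ys)))
∑-swap f (x ∷ xs) ys = trans (cong (∑ (f x) ys +_) (∑-swap f xs ys)) (sym (∑-+ (f x) _ ys))

module Greedy {A B : Set} (hit : A → B → Bool) (items : List B) (c : ℕ) where

  hits : List A → B → ℕ
  hits S b = countᵇ (λ a → hit a b) S

  isOpen : List A → B → Bool
  isOpen S b = hits S b <ᵇ c

  load : List A → A → ℕ
  load S a = countᵇ (λ b → hit a b ∧ isOpen S b) items

  -- The potential of the greedy choice: the coverage still lacking, which each added element lowers
  -- by exactly its load.
  residue : List A → ℕ
  residue S = ∑ (λ b → c ∸ hits S b) items

  residue-∷ : ∀ a S → residue S ≡ residue (a ∷ S) + load S a
  residue-∷ a S = trans (∑-cong (λ b → pointwise (hit a b) (hits S b) c) items) (∑-+ _ _ items)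
    where
    pointwise : ∀ h k c → c ∸ k ≡ (c ∸ (𝟙 h + k)) + 𝟙 (h ∧ (k <ᵇ c))
    pointwise false k       c       = sym (+-identityʳ _)
    pointwise true  k       zero    = trans (0∸n≡0 k) refl
    pointwise true  zero    (suc c) = +-comm 1 c
    pointwise true  (suc k) (suc c) = pointwise true k c

  -- Loads only fall as `S` grows, so an element once found light stays light and a single pass
  -- suffices.
  load-∷ : ∀ a S a′ → load (a ∷ S) a′ ≤ load S a′
  load-∷ a S a′ = ∑-mono items λ {b} _ → pointwise (hit a b) (hit a′ b) (hits S b) c
    where
    anti : ∀ h k c → 𝟙 (𝟙 h + k <ᵇ c) ≤ 𝟙 (k <ᵇ c)
    anti false k       c             = ≤-refl
    anti true  k       zero          = z≤n
    anti true  zero    (suc zero)    = z≤n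
    anti true  zero    (suc (suc c)) = ≤-refl
    anti true  (suc k) (suc c)       = anti true k c

    pointwise : ∀ h h′ k c → 𝟙 (h′ ∧ (𝟙 h + k <ᵇ c)) ≤ 𝟙 (h′ ∧ (k <ᵇ c))
    pointwise h true  k c = anti h k c
    pointwise h false k c = z≤n

  abstract
    -- An element is taken when its load is at least `β / α`; the drop of the potential pays for it.
    -- The threshold is a ratio because `half-cover` needs a rational one.
    greedy : ∀ α β as → ∃[ S ] (S ⊆ as × length S * β + α * residue S ≤ α * residue [] ×
                                (∀ a → a ∈ as → a ∈ S ⊎ α * load S a < β))
    greedy α β [] = [] , [] , ≤-refl , λ _ ()
    greedy α β (a ∷ as) with greedy α β as
    ... | S , S⊆as , size , light with β ≤? α * load S a
    ...   | yes heavy = a ∷ S , refl ∷ S⊆as , size′ , λ where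
              a′ (here refl) → inj₁ (here refl)
              a′ (there m)   → case′ a′ (light a′ m)
            where
            case′ : ∀ a′ → a′ ∈ S ⊎ α * load S a′ < β → a′ ∈ a ∷ S ⊎ α * load (a ∷ S) a′ < β
            case′ a′ (inj₁ m) = inj₁ (there m)
            case′ a′ (inj₂ l) = inj₂ (≤-<-trans (*-monoʳ-≤ α (load-∷ a S a′)) l)

            open ≤-Reasoning
            size′ : β + length S * β + α * residue (a ∷ S) ≤ α * residue []
            size′ = begin
              β + length S * β + α * residue (a ∷ S)
                ≤⟨ +-monoˡ-≤ _ (+-monoˡ-≤ _ heavy) ⟩
              α * load S a + length S * β + α * residue (a ∷ S)
                ≡⟨ rearrange α (load S a) (length S * β) (residue (a ∷ S)) ⟩
              length S * β + α * (residue (a ∷ S) + load S a)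
                ≡⟨ cong (λ r → length S * β + α * r) (sym (residue-∷ a S)) ⟩
              length S * β + α * residue S
                ≤⟨ size ⟩
              α * residue [] ∎
              where
              rearrange : ∀ α l m r → α * l + m + α * r ≡ m + α * (r + l)
              rearrange = solve-∀
    ...   | no  light′ = S , a ∷ʳ S⊆as , size , λ where
              a′ (here refl) → inj₂ (≰⇒> light′)
              a′ (there m)   → light a′ m

  residue-[] : residue [] ≡ length items * c
  residue-[] = ∑-const c items

-- By double counting: every missed set has d elements, and the greedy choice leaves no element in many missed sets.
half-cover : ∀ {A B : Set} (hit : A → B → Bool) (as : List A) (items : List B) d → 1 ≤ d →
             (∀ {b} → b ∈ items → d ≤ countᵇ (λ a → hit a b) as) →
             ∃[ R ] (length R * d ≤ 2 * length as ×
                     length items ≤ 2 * countᵇ (λ b → 0 <ᵇ countᵇ (λ a → hit a b) R) items)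
half-cover hit as [] d 1≤d dense = [] , z≤n , z≤n
half-cover hit [] (_ ∷ _) d 1≤d dense = ⊥-elim (<⇒≱ 1≤d (dense (here refl)))
half-cover {A} {B} hit as@(_ ∷ _) items@(_ ∷ _) d 1≤d dense = R , few , many
  where
  open Greedy hit items 1
  L = length as
  K = length items
  -- The threshold K * d / (2 * L) is half of what the average initial load must reach, as each of
  -- the `K` sets has at least `d` elements.
  chosen = greedy (2 * L) (K * d) as
  R = proj₁ chosen
  size = proj₁ (proj₂ (proj₂ chosen))
  light = proj₂ (proj₂ (proj₂ chosen))

  open ≤-Reasoning

  few : length R * d ≤ 2 * L
  few = *-cancelˡ-≤ K (begin
    K * (length R * d)                                ≡⟨ shuffle K (length R) d ⟩
    length R * (K * d)                                ≤⟨ m≤m+n _ _ ⟩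
    length R * (K * d) + 2 * L * residue R            ≤⟨ size ⟩
    2 * L * residue []                                ≡⟨ cong (2 * L *_) residue-[] ⟩
    2 * L * (K * 1)                                   ≡⟨ shuffle′ L K ⟩
    K * (2 * L)                                       ∎)
    where
    shuffle : ∀ a b c → a * (b * c) ≡ b * (a * c)
    shuffle = solve-∀
    shuffle′ : ∀ a b → 2 * a * (b * 1) ≡ b * (2 * a)
    shuffle′ = solve-∀

  missed = countᵇ (isOpen R) items

  -- With `c = 1` a set is open only while unhit, so a chosen element lies in no open set.
  member-load : ∀ {a} S → a ∈ S → load S a ≡ 0
  member-load {a} S m = trans (∑-cong (λ b → zero-term b (hit a b) refl) items)
                              (trans (∑-const 0 items) (*-zeroʳ K))
    where
    positive : ∀ {a} b S → a ∈ S → hit a b ≡ true → 1 ≤ hits S b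
    positive b (a ∷ S) (here refl) h rewrite h = s≤s z≤n
    positive b (a ∷ S) (there m)   h = ≤-trans (positive b S m h) (m≤n+m _ _)
    not-open : ∀ k → 1 ≤ k → (k <ᵇ 1) ≡ false
    not-open (suc k) _ = refl
    zero-term : ∀ b h → hit a b ≡ h → 𝟙 (h ∧ isOpen S b) ≡ 0
    zero-term b false _  = refl
    zero-term b true  eq rewrite not-open _ (positive b S m eq) = refl

  load-bound : ∀ {a} → a ∈ as → 2 * L * load R a ≤ K * d
  load-bound {a} m with light a m
  ... | inj₁ a∈R = ≤-trans (≤-reflexive (trans (cong (2 * L *_) (member-load R a∈R)) (*-zeroʳ (2 * L)))) z≤n
  ... | inj₂ l   = <⇒≤ l

  double-count : d * missed ≤ ∑ (load R) as
  double-count = begin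
    d * missed                                                              ≡⟨ ∑-* d _ items ⟨
    ∑ (λ b → d * 𝟙 (isOpen R b)) items                                       ≤⟨ ∑-mono items (λ {b} m → column b (isOpen R b) refl (dense m)) ⟩
    ∑ (λ b → countᵇ (λ a → hit a b ∧ isOpen R b) as) items                   ≡⟨ ∑-swap (λ a b → 𝟙 (hit a b ∧ isOpen R b)) as items ⟨
    ∑ (load R) as                                                           ∎
    where
    column : ∀ b o → isOpen R b ≡ o → d ≤ countᵇ (λ a → hit a b) as → d * 𝟙 o ≤ countᵇ (λ a → hit a b ∧ o) as
    column b false _ _ = ≤-trans (≤-reflexive (*-zeroʳ d)) z≤n
    column b true  _ h = begin
      d * 1                            ≡⟨ *-identityʳ d ⟩
      d                                ≤⟨ h ⟩
      countᵇ (λ a → hit a b) as        ≡⟨ ∑-cong (λ a → cong 𝟙 (∧-true (hit a b))) as ⟩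
      countᵇ (λ a → hit a b ∧ true) as ∎
      where
      ∧-true : ∀ h → h ≡ h ∧ true
      ∧-true true  = refl
      ∧-true false = refl

  split : missed + countᵇ (λ b → 0 <ᵇ hits R b) items ≡ K
  split = trans (sym (∑-+ (𝟙 ∘ isOpen R) (λ b → 𝟙 (0 <ᵇ hits R b)) items))
         (trans (∑-cong (λ b → complement (hits R b)) items)
         (trans (∑-const 1 items) (*-identityʳ K)))
    where
    complement : ∀ k → 𝟙 (k <ᵇ 1) + 𝟙 (0 <ᵇ k) ≡ 1
    complement zero    = refl
    complement (suc k) = refl

  missed-half : 2 * missed ≤ K
  missed-half = *-cancelˡ-≤ (d * L) {{m*n≢0 d L {{>-nonZero 1≤d}}}} (begin
    d * L * (2 * missed)            ≡⟨ shuffle d L missed ⟩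
    2 * L * (d * missed)            ≤⟨ *-monoʳ-≤ (2 * L) double-count ⟩
    2 * L * ∑ (load R) as           ≡⟨ ∑-* (2 * L) (load R) as ⟨
    ∑ (λ a → 2 * L * load R a) as   ≤⟨ ∑-mono as load-bound ⟩
    ∑ (λ _ → K * d) as              ≡⟨ ∑-const (K * d) as ⟩
    L * (K * d)                     ≡⟨ shuffle′ L K d ⟩
    d * L * K                       ∎)
    where
    shuffle : ∀ d l m → d * l * (2 * m) ≡ 2 * l * (d * m)
    shuffle = solve-∀
    shuffle′ : ∀ l k d → l * (k * d) ≡ d * l * k
    shuffle′ = solve-∀

  many : K ≤ 2 * countᵇ (λ b → 0 <ᵇ hits R b) items
  many = begin
    K                       ≤⟨ +-cancelˡ-≤ K _ _ (begin
      K + K                                   ≡⟨ cong₂ _+_ split split ⟨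
      (missed + covered) + (missed + covered) ≡⟨ shuffle missed covered ⟩
      2 * missed + 2 * covered                ≤⟨ +-monoˡ-≤ _ missed-half ⟩
      K + 2 * covered                         ∎) ⟩
    2 * covered             ∎
    where
    covered = countᵇ (λ b → 0 <ᵇ hits R b) items
    shuffle : ∀ m c → (m + c) + (m + c) ≡ 2 * m + 2 * c
    shuffle = solve-∀

-- Digits

-- For fewer than `K` exponents, `zeros` is the last digit in base `K` of the sum of the powers
-- `K ^ i`, and `preds` lists the exponents of the quotient by `K`.
zeros : List ℕ → ℕ
zeros []           = 0
zeros (zero  ∷ xs) = suc (zeros xs)
zeros (suc _ ∷ xs) = zeros xs

preds : List ℕ → List ℕ
preds []           = []
preds (zero  ∷ xs) = preds xs
preds (suc i ∷ xs) = i ∷ preds xs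

module _ (K : ℕ) .{{_ : NonZero K}} where

  powerSum : List ℕ → ℕ
  powerSum = ∑ (K ^_)

  powerSum-step : ∀ xs → powerSum xs ≡ zeros xs + powerSum (preds xs) * K
  powerSum-step []           = refl
  powerSum-step (zero ∷ xs)  = cong suc (powerSum-step xs)
  powerSum-step (suc i ∷ xs) = trans (cong (K * K ^ i +_) (powerSum-step xs)) (shuffle K (K ^ i) _ _)
    where
    shuffle : ∀ a b z s → a * b + (z + s * a) ≡ z + (b + s) * a
    shuffle = solve-∀

  private
    zeros≤ : ∀ xs → zeros xs ≤ length xs
    zeros≤ []           = z≤n
    zeros≤ (zero  ∷ xs) = s≤s (zeros≤ xs)
    zeros≤ (suc _ ∷ xs) = m≤n⇒m≤1+n (zeros≤ xs)

    preds≤ : ∀ xs → length (preds xs) ≤ length xs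
    preds≤ []           = z≤n
    preds≤ (zero  ∷ xs) = m≤n⇒m≤1+n (preds≤ xs)
    preds≤ (suc _ ∷ xs) = s≤s (preds≤ xs)

    zeros⁺ : ∀ {xs} → 0 ∈ xs → 1 ≤ zeros xs
    zeros⁺ (here refl)             = s≤s z≤n
    zeros⁺ {zero  ∷ xs} (there _)  = s≤s z≤n
    zeros⁺ {suc _ ∷ xs} (there m)  = zeros⁺ m

    zeros⁻ : ∀ xs → 1 ≤ zeros xs → 0 ∈ xs
    zeros⁻ (zero  ∷ xs) _ = here refl
    zeros⁻ (suc _ ∷ xs) h = there (zeros⁻ xs h)

    preds⁺ : ∀ {i xs} → suc i ∈ xs → i ∈ preds xs
    preds⁺ (here refl)            = here refl
    preds⁺ {xs = zero  ∷ xs} (there m) = preds⁺ m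
    preds⁺ {xs = suc _ ∷ xs} (there m) = there (preds⁺ m)

    preds⁻ : ∀ {i} xs → i ∈ preds xs → suc i ∈ xs
    preds⁻ (zero  ∷ xs) m           = there (preds⁻ xs m)
    preds⁻ (suc _ ∷ xs) (here refl) = here refl
    preds⁻ (suc _ ∷ xs) (there m)   = there (preds⁻ xs m)

  -- Fewer than `K` exponents cannot produce a carry, so the digits are multiplicities. Remainders
  -- modulo `K` settle exponent 0, and the quotients settle the larger ones by induction.
  powerSum-∈ : ∀ i xs ys → length xs < K → length ys < K → powerSum xs ≡ powerSum ys → i ∈ xs → i ∈ ys
  powerSum-∈ i xs ys xs< ys< eq i∈ = digit i i∈
    where
    eq′ : zeros xs + powerSum (preds xs) * K ≡ zeros ys + powerSum (preds ys) * K
    eq′ = trans (sym (powerSum-step xs)) (trans eq (powerSum-step ys))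

    last-digit : ∀ zs → length zs < K → (zeros zs + powerSum (preds zs) * K) % K ≡ zeros zs
    last-digit zs zs< = trans ([m+kn]%n≡m%n (zeros zs) (powerSum (preds zs)) K)
                              (m<n⇒m%n≡m (≤-<-trans (zeros≤ zs) zs<))

    zeros-≡ : zeros xs ≡ zeros ys
    zeros-≡ = trans (sym (last-digit xs xs<)) (trans (cong (_% K) eq′) (last-digit ys ys<))

    rest-≡ : powerSum (preds xs) ≡ powerSum (preds ys)
    rest-≡ = *-cancelʳ-≡ _ _ K (+-cancelˡ-≡ (zeros xs) _ _
               (trans eq′ (cong (_+ powerSum (preds ys) * K) (sym zeros-≡))))

    digit : ∀ i → i ∈ xs → i ∈ ys
    digit zero    m = zeros⁻ ys (subst (1 ≤_) zeros-≡ (zeros⁺ m))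
    digit (suc i) m = preds⁻ ys (powerSum-∈ i (preds xs) (preds ys) (≤-<-trans (preds≤ xs) xs<)
                                   (≤-<-trans (preds≤ ys) ys<) rest-≡ (preds⁺ m))

-- Paths

Adjacency : ℕ → Set
Adjacency n = Fin n → Fin n → Bool

-- A walk from v to s, given by the list of vertices visited after v.
data Path {n} (A : Adjacency n) : Fin n → List (Fin n) → Fin n → Set where
  []  : ∀ {v} → Path A v [] v
  _∷_ : ∀ {v u xs s} → A v u ≡ true → Path A u xs s → Path A v (u ∷ xs) s

module _ {n} {A : Adjacency n} where

  path-++ : ∀ {v xs m ys s} → Path A v xs m → Path A m ys s → Path A v (xs ++ ys) s
  path-++ []      q = q
  path-++ (a ∷ p) q = a ∷ path-++ p q

  path-split : ∀ {v} xs {ys s} → Path A v (xs ++ ys) s → ∃[ m ] (Path A v xs m × Path A m ys s)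
  path-split []       p       = _ , [] , p
  path-split (x ∷ xs) (a ∷ p) with path-split xs p
  ... | m , q , r = m , a ∷ q , r

  path? : ∀ v xs s → Dec (Path A v xs s)
  path? v [] s with v ≟ s
  ... | yes refl = yes []
  ... | no v≢s   = no λ { [] → v≢s refl }
  path? v (u ∷ xs) s = map′ (λ (a , p) → a ∷ p) (λ { (a ∷ p) → a , p }) ((A v u Bool.≟ true) ×-dec path? u xs s)

path-mono : ∀ {n} {A B : Adjacency n} → (∀ u v → A u v ≡ true → B u v ≡ true) →
            ∀ {v xs s} → Path A v xs s → Path B v xs s
path-mono A≤B []      = []
path-mono A≤B (a ∷ p) = A≤B _ _ a ∷ path-mono A≤B p

-- Bounded search

module _ {A : Set} (search : ∀ {P : A → Set} → (∀ a → Dec (P a)) → Dec (∃ P)) where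

  ∃-list≤? : ∀ k {P : List A → Set} → (∀ xs → Dec (P xs)) → Dec (∃[ xs ] (length xs ≤ k × P xs))
  ∃-list≤? zero P? = map′ (λ p → [] , z≤n , p) (λ { ([] , _ , p) → p }) (P? [])
  ∃-list≤? (suc k) P? with P? []
  ... | yes p = yes ([] , z≤n , p)
  ... | no ¬p with search (λ a → ∃-list≤? k (λ xs → P? (a ∷ xs)))
  ...   | yes (a , xs , l , p) = yes (a ∷ xs , s≤s l , p)
  ...   | no  ¬q = no λ { ([] , _ , p) → ¬p p ; (a ∷ xs , s≤s l , p) → ¬q (a , xs , l , p) }

-- Perturbed weights

module Weights (n : ℕ) where

  open import Data.List.Membership.DecPropositional (_≟_ {n}) using (_∈?_)

  -- More than the 2n arcs of two simple paths, so that their perturbations add up without carries.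
  base : ℕ
  base = suc (n + n)

  index : Fin n → Fin n → ℕ
  index u v = toℕ (combine u v)

  -- D outweighs the total perturbation of any path with at most n arcs.
  P D M : ℕ
  P = base ^ (n * n)
  D = suc (n + n) * P
  M = D + P

  perturbation : Fin n → Fin n → ℕ
  perturbation u v = base ^ index u v

  perturbation≤P : ∀ u v → perturbation u v ≤ P
  perturbation≤P u v = ^-monoʳ-≤ base (<⇒≤ (toℕ<n (combine u v)))

  1≤P : 1 ≤ P
  1≤P = m^n>0 base (n * n)

  -- Each arc carries its own tiny perturbation, subtracted on the reverse arc.
  weight : Fin n → Fin n → ℕ
  weight u v = (M + perturbation u v) ∸ perturbation v u

  weight-balance : ∀ u v → weight u v + perturbation v u ≡ M + perturbation u v
  weight-balance u v = m∸n+n≡m (≤-trans (perturbation≤P v u) (≤-trans (m≤n+m P D) (m≤m+n M _)))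

  -- Lets two opposite crossings of one edge be traded for two opposite crossings of another, as
  -- `crossing` does.
  weight-antisym : ∀ u v → weight u v + weight v u ≡ M + M
  weight-antisym u v = +-cancelʳ-≡ (p v u + p u v) _ _
    (trans (shuffle (weight u v) (weight v u) (p v u) (p u v))
    (trans (cong₂ _+_ (weight-balance u v) (weight-balance v u)) (shuffle′ M (p u v) (p v u))))
    where
    p = perturbation
    shuffle : ∀ a b c d → a + b + (c + d) ≡ (a + c) + (b + d)
    shuffle = solve-∀
    shuffle′ : ∀ m a b → m + a + (m + b) ≡ m + m + (b + a)
    shuffle′ = solve-∀

  D≤weight : ∀ u v → D ≤ weight u v
  D≤weight u v = +-cancelʳ-≤ (perturbation v u) _ _ (begin
    D + perturbation v u          ≤⟨ +-monoʳ-≤ D (perturbation≤P v u) ⟩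
    M                             ≤⟨ m≤m+n M _ ⟩
    M + perturbation u v          ≡⟨ weight-balance u v ⟨
    weight u v + perturbation v u ∎)
    where open ≤-Reasoning

  weight≤ : ∀ u v → weight u v ≤ D + (P + P)
  weight≤ u v = ≤-trans (m∸n≤m _ (perturbation v u))
                (≤-trans (+-monoʳ-≤ M (perturbation≤P u v)) (≤-reflexive (+-assoc D P P)))

  0<D : 0 < D
  0<D = ≤-trans 1≤P (m≤m+n P _)

  0<weight : ∀ u v → 0 < weight u v
  0<weight u v = ≤-trans 0<D (D≤weight u v)

  cost : Fin n → List (Fin n) → ℕ
  cost v []       = 0
  cost v (u ∷ xs) = weight v u + cost u xs

  cost-++ : ∀ {A v xs m} ys → Path A v xs m → cost v (xs ++ ys) ≡ cost v xs + cost m ys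
  cost-++ ys []      = refl
  cost-++ ys (_∷_ {v} {u} {xs} _ p) = trans (cong (weight v u +_) (cost-++ ys p)) (sym (+-assoc (weight v u) (cost u xs) _))

  cost-lower : ∀ v xs → length xs * D ≤ cost v xs
  cost-lower v []       = z≤n
  cost-lower v (u ∷ xs) = +-mono-≤ (D≤weight v u) (cost-lower u xs)

  cost-upper : ∀ v xs → cost v xs ≤ length xs * (D + (P + P))
  cost-upper v []       = z≤n
  cost-upper v (u ∷ xs) = +-mono-≤ (weight≤ v u) (cost-upper u xs)

  -- Each arc exceeds `D` by at most `2 * P`, so `n` arcs exceed it by less than `D` altogether:
  -- cost compares lengths first.
  shorter⇒cheaper : ∀ {v v′} xs ys → length xs ≤ n → length xs < length ys → cost v xs < cost v′ ys
  shorter⇒cheaper {v} {v′} xs ys l≤n l< = begin-strict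
    cost v xs                          ≤⟨ cost-upper v xs ⟩
    length xs * (D + (P + P))          ≡⟨ *-distribˡ-+ (length xs) D (P + P) ⟩
    length xs * D + length xs * (P + P) ≤⟨ +-monoʳ-≤ (length xs * D) (*-monoˡ-≤ (P + P) l≤n) ⟩
    length xs * D + n * (P + P)        <⟨ +-monoʳ-< (length xs * D) small ⟩
    length xs * D + D                  ≡⟨ +-comm (length xs * D) D ⟩
    suc (length xs) * D                ≤⟨ *-monoˡ-≤ D l< ⟩
    length ys * D                      ≤⟨ cost-lower v′ ys ⟩
    cost v′ ys                         ∎
    where
    open ≤-Reasoning
    shuffle : ∀ n p → n * (p + p) ≡ (n + n) * p
    shuffle = solve-∀
    small : n * (P + P) < D
    small = begin-strict
      n * (P + P)     ≡⟨ shuffle n P ⟩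
      (n + n) * P     <⟨ m<n+m _ 1≤P ⟩
      D               ∎

  IsMin : Adjacency n → Fin n → List (Fin n) → Fin n → Set
  IsMin A v xs s = Path A v xs s × (∀ ys → Path A v ys s → cost v xs ≤ cost v ys)

  Unique⇒length<n : ∀ {v : Fin n} {xs} → Unique (v ∷ xs) → length xs < n
  Unique⇒length<n {v} {xs} u = subst (suc (length xs) ≤_) (length-tabulate (λ i → i))
                                 (Unique⇒length≤ u λ {z} _ → ∈-allFin z)

  module _ {A : Adjacency n} where

    path-from : ∀ {x u xs s} → x ∈ xs → Path A u xs s →
                ∃[ ys ] (Path A x ys s × cost x ys < cost u xs × length ys ≤ length xs × (Unique xs → Unique (x ∷ ys)))
    path-from {u = u} {xs = x ∷ xs} (here refl) (_ ∷ p) =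
      xs , p , m<n+m _ (0<weight u x) , n≤1+n _ , λ un → un
    path-from {u = u} {xs = y ∷ xs} (there m) (_ ∷ p) with path-from m p
    ... | ys , q , c , l , un = ys , q , <-≤-trans c (m≤n+m _ (weight u y)) , m≤n⇒m≤1+n l , λ { (_ ∷ d) → un d }

    -- Loop erasure. It confines every search for a cheaper path to lists of length at most `n`.
    shorten : ∀ {v xs s} → Path A v xs s →
              ∃[ ys ] (Path A v ys s × Unique (v ∷ ys) × cost v ys ≤ cost v xs × length ys ≤ length xs)
    shorten [] = [] , [] , [] ∷ [] , z≤n , z≤n
    shorten {v} {u ∷ xs} (a ∷ p) with shorten p
    ... | ys , q , un , c , l with v ∈? (u ∷ ys)
    ...   | no v∉ = u ∷ ys , a ∷ q , All.¬Any⇒All¬ _ v∉ ∷ un , +-monoʳ-≤ (weight v u) c , s≤s l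
    ...   | yes v∈ with path-from v∈ (a ∷ q)
    ...     | zs , r , c′ , l′ , un′ =
              zs , r , un′ un , ≤-trans (<⇒≤ c′) (+-monoʳ-≤ (weight v u) c) , ≤-trans l′ (s≤s l)

    min-length : ∀ {v xs s ys} → IsMin A v xs s → Path A v ys s → length xs ≤ length ys
    min-length {v} {xs} {s} {ys} (_ , min) p with shorten p
    ... | zs , q , un , _ , l with length xs ≤? length zs
    ...   | yes h = ≤-trans h l
    ...   | no  h = ⊥-elim (<⇒≱ (shorter⇒cheaper {v} {v} zs xs (<⇒≤ (Unique⇒length<n un)) (≰⇒> h)) (min zs q))

    min-length≤n : ∀ {v xs s} → IsMin A v xs s → length xs ≤ n
    min-length≤n m@(p , _) with shorten p
    ... | _ , q , un , _ = ≤-trans (min-length m q) (<⇒≤ (Unique⇒length<n un))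

    min-suffix : ∀ {v} xs {ys s} → IsMin A v (xs ++ ys) s → ∃[ m ] (Path A v xs m × IsMin A m ys s)
    min-suffix {v} xs {ys} (p , min) with path-split xs p
    ... | m , q , r = m , q , r , λ zs z → +-cancelˡ-≤ (cost v xs) _ _
          (subst₂ _≤_ (cost-++ ys q) (cost-++ zs q) (min (xs ++ zs) (path-++ q z)))

    min-tail : ∀ {v u xs s} → IsMin A v (u ∷ xs) s → IsMin A u xs s
    min-tail {v} {u} ((a ∷ p) , min) = p , λ ys q → +-cancelˡ-≤ (weight v u) _ _ (min (u ∷ ys) (a ∷ q))

    min-prefix : ∀ {v} xs {ys s} → IsMin A v (xs ++ ys) s → ∃[ m ] (IsMin A v xs m × Path A m ys s)
    min-prefix {v} xs {ys} (p , min) with path-split xs p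
    ... | m , q , r = m , (q , λ zs z → +-cancelʳ-≤ (cost m ys) _ _
          (subst₂ _≤_ (cost-++ ys q) (cost-++ ys z) (min (zs ++ ys) (path-++ z r)))) , r

    min-Unique : ∀ {v xs s} → IsMin A v xs s → Unique (v ∷ xs)
    min-Unique {v} {[]} _ = [] ∷ []
    min-Unique {v} {u ∷ xs} m@(p , min) = All.¬Any⇒All¬ _ fresh ∷ min-Unique (min-tail m)
      where
      fresh : v ∉ u ∷ xs
      fresh v∈ with path-from v∈ p
      ... | ys , q , c , _ = <⇒≱ c (min ys q)

    -- Descent on the cost: a bounded search either finds a cheaper path or, by `shorten`, proves
    -- that there is none of any length.
    ∃-min : ∀ {v xs s} → Path A v xs s → ∃[ ys ] IsMin A v ys s
    ∃-min {v} {xs} {s} p = go xs p (<-wellFounded (cost v xs))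
      where
      go : ∀ xs → Path A v xs s → Acc _<_ (cost v xs) → ∃[ ys ] IsMin A v ys s
      go xs p (acc rec) with ∃-list≤? any? n (λ ys → path? {A = A} v ys s ×-dec (cost v ys <? cost v xs))
      ... | yes (ys , _ , q , c) = go ys q (rec c)
      ... | no  none = xs , p , minimal
        where
        minimal : ∀ ys → Path A v ys s → cost v xs ≤ cost v ys
        minimal ys q with shorten q
        ... | zs , r , un , c , _ with cost v zs <? cost v xs
        ...   | yes h = ⊥-elim (none (zs , <⇒≤ (Unique⇒length<n un) , r , h))
        ...   | no  h = ≤-trans (≮⇒≥ h) c

  -- Uniqueness of minimal paths

  forward backward : Fin n → List (Fin n) → List ℕ
  forward v []        = []
  forward v (u ∷ xs)  = index v u ∷ forward u xs
  backward v []       = []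
  backward v (u ∷ xs) = index u v ∷ backward u xs

  length-forward : ∀ v xs → length (forward v xs) ≡ length xs
  length-forward v []       = refl
  length-forward v (u ∷ xs) = cong suc (length-forward u xs)

  length-backward : ∀ v xs → length (backward v xs) ≡ length xs
  length-backward v []       = refl
  length-backward v (u ∷ xs) = cong suc (length-backward u xs)

  index-injective : ∀ {a b c d} → index a b ≡ index c d → a ≡ c × b ≡ d
  index-injective {a} {b} {c} {d} eq = combine-injective a b c d (toℕ-injective eq)

  ∈-forward : ∀ {a b} x xs → index a b ∈ forward x xs → a ∈ x ∷ xs
  ∈-forward x (u ∷ xs) (here eq) = here (proj₁ (index-injective eq))
  ∈-forward x (u ∷ xs) (there m) = there (∈-forward u xs m)

  ∈-backward : ∀ {a b} x xs → index a b ∈ backward x xs → a ∈ xs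
  ∈-backward x (u ∷ xs) (here eq) = here (proj₁ (index-injective eq))
  ∈-backward x (u ∷ xs) (there m) = there (∈-backward u xs m)

  -- The subtracted perturbations stand on the left as digits of their own, so equal costs and
  -- lengths turn into equal sums of powers of `base`.
  cost-balance : ∀ v xs → cost v xs + powerSum base (backward v xs) ≡ length xs * M + powerSum base (forward v xs)
  cost-balance v []       = refl
  cost-balance v (u ∷ xs) = trans (shuffle (weight v u) (cost u xs) (perturbation u v) _)
    (trans (cong₂ _+_ (weight-balance v u) (cost-balance u xs))
           (shuffle M (perturbation v u) (length xs * M) _))
    where
    shuffle : ∀ a b c d → a + b + (c + d) ≡ (a + c) + (b + d)
    shuffle = solve-∀

  module _ {A : Adjacency n} where

    -- Two minimal paths R and Q of equal cost and length give arcs(R) + reversed(Q) and arcs(Q) + reversed(R) the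
    -- same digit sum, so the first arc of R lies on Q; minimal paths do not return to v, so it is first on Q too.
    min-first : ∀ {v u u′ xs ys s} → IsMin A v (u ∷ xs) s → IsMin A v (u′ ∷ ys) s → u ≡ u′
    min-first {v} {u} {u′} {xs} {ys} m@(p , min) m′@(p′ , min′) = conclude (∈-++⁻ (forward v Q) arc∈)
      where
      R = u ∷ xs
      Q = u′ ∷ ys

      same-cost : cost v R ≡ cost v Q
      same-cost = ≤-antisym (min Q p′) (min′ R p)

      same-length : length R ≡ length Q
      same-length = ≤-antisym (min-length m p′) (min-length m′ p)

      powerSum-++ : ∀ as bs → powerSum base (as ++ bs) ≡ powerSum base as + powerSum base bs
      powerSum-++ as bs = trans (cong sum (map-++ (base ^_) as bs)) (sum-++ (map (base ^_) as) _)

      same-sum : powerSum base (forward v R ++ backward v Q) ≡ powerSum base (forward v Q ++ backward v R)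
      same-sum = trans (powerSum-++ (forward v R) _) (trans (+-cancelˡ-≡ (cost v R + length R * M) _ _
        (trans (shuffle (cost v R) (length R * M) (powerSum base (forward v R)) (powerSum base (backward v Q)))
        (trans (cong₂ _+_ (sym (cost-balance v R))
                  (trans (cong (_+ powerSum base (backward v Q)) same-cost)
                  (trans (cost-balance v Q) (cong (λ l → l * M + powerSum base (forward v Q)) (sym same-length)))))
               (shuffle′ (cost v R) (powerSum base (backward v R)) (length R * M) (powerSum base (forward v Q))))))
        (sym (powerSum-++ (forward v Q) _)))
        where
        shuffle : ∀ c l f b → c + l + (f + b) ≡ (l + f) + (c + b)
        shuffle = solve-∀
        shuffle′ : ∀ c b l f → c + b + (l + f) ≡ c + l + (f + b)
        shuffle′ = solve-∀

      few : ∀ {as bs} → length as ≤ n → length bs ≤ n → length (forward v as ++ backward v bs) < base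
      few {as} {bs} la lb = s≤s (≤-trans (≤-reflexive (trans (length-++ (forward v as))
                                (cong₂ _+_ (length-forward v as) (length-backward v bs)))) (+-mono-≤ la lb))

      arc∈ : index v u ∈ forward v Q ++ backward v R
      arc∈ = powerSum-∈ base (index v u) (forward v R ++ backward v Q) _
               (few {R} {Q} (min-length≤n m) (min-length≤n m′)) (few {Q} {R} (min-length≤n m′) (min-length≤n m))
               same-sum (here refl)

      not-revisited : ∀ {zs} → Unique (v ∷ zs) → v ∉ zs
      not-revisited (v∉ ∷ _) v∈ = All.lookup v∉ v∈ refl

      conclude : index v u ∈ forward v Q ⊎ index v u ∈ backward v R → u ≡ u′
      conclude (inj₁ (here eq)) = proj₂ (index-injective eq)
      conclude (inj₁ (there i)) = ⊥-elim (not-revisited (min-Unique m′) (∈-forward u′ ys i))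
      conclude (inj₂ i)         = ⊥-elim (not-revisited (min-Unique m) (∈-backward v R i))

    min-unique : ∀ {v xs ys s} → IsMin A v xs s → IsMin A v ys s → xs ≡ ys
    min-unique {xs = []}     {[]}     _ _ = refl
    min-unique {v} {xs = []} {u ∷ ys} ([] , _) (_ , min) =
      ⊥-elim (<⇒≱ (≤-trans (0<weight v u) (m≤m+n _ _)) (min [] []))
    min-unique {v} {xs = u ∷ xs} {[]} (_ , min) ([] , _) =
      ⊥-elim (<⇒≱ (≤-trans (0<weight v u) (m≤m+n _ _)) (min [] []))
    min-unique {xs = u ∷ xs} {u′ ∷ ys} m m′ with min-first m m′
    ... | refl = cong (u ∷_) (min-unique (min-tail m) (min-tail m′))

-- Faults

Link : ∀ {n} → Fin n × Fin n → Fin n → Fin n → Set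
Link e u v = e ≡ (u , v) ⊎ e ≡ (v , u)

link-sym : ∀ {n} {e : Fin n × Fin n} {u v} → Link e u v → Link e v u
link-sym (inj₁ p) = inj₂ p
link-sym (inj₂ p) = inj₁ p

link-two : ∀ {n} {e : Fin n × Fin n} {a b c d} → Link e a b → Link e c d → (c ≡ a × d ≡ b) ⊎ (c ≡ b × d ≡ a)
link-two (inj₁ refl) (inj₁ refl) = inj₁ (refl , refl)
link-two (inj₁ refl) (inj₂ refl) = inj₂ (refl , refl)
link-two (inj₂ refl) (inj₁ refl) = inj₂ (refl , refl)
link-two (inj₂ refl) (inj₂ refl) = inj₁ (refl , refl)

linkᵇ : ∀ {n} → Fin n × Fin n → Fin n → Fin n → Bool
linkᵇ (a , b) u v = (⌊ a ≟ u ⌋ ∧ ⌊ b ≟ v ⌋) ∨ (⌊ a ≟ v ⌋ ∧ ⌊ b ≟ u ⌋)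

linkᵇ⁺ : ∀ {n} (e : Fin n × Fin n) {u v} → Link e u v → linkᵇ e u v ≡ true
linkᵇ⁺ (a , b) {u} {v} l with a ≟ u | b ≟ v | a ≟ v | b ≟ u | l
... | yes _ | yes _ | _     | _     | _         = refl
... | yes _ | no _  | yes _ | yes _ | _         = refl
... | no _  | _     | yes _ | yes _ | _         = refl
... | no p  | _     | _     | _     | inj₁ refl = ⊥-elim (p refl)
... | _     | no p  | _     | _     | inj₁ refl = ⊥-elim (p refl)
... | _     | _     | no p  | _     | inj₂ refl = ⊥-elim (p refl)
... | _     | _     | _     | no p  | inj₂ refl = ⊥-elim (p refl)

linkᵇ⁻ : ∀ {n} (e : Fin n × Fin n) {u v} → linkᵇ e u v ≡ true → Link e u v
linkᵇ⁻ (a , b) {u} {v} h with a ≟ u | b ≟ v | a ≟ v | b ≟ u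
... | yes refl | yes refl | _        | _        = inj₁ refl
... | yes _    | no _     | yes refl | yes refl = inj₂ refl
... | no _     | _        | yes refl | yes refl = inj₂ refl
linkᵇ⁻ (a , b) () | yes _ | no _ | yes _ | no _
linkᵇ⁻ (a , b) () | yes _ | no _ | no _  | _
linkᵇ⁻ (a , b) () | no _  | _    | yes _ | no _
linkᵇ⁻ (a , b) () | no _  | _    | no _  | _

module _ {A : Set} {p : A → Bool} where

  any-true⁺ : ∀ {xs x} → x ∈ xs → p x ≡ true → any p xs ≡ true
  any-true⁺ (here refl) px rewrite px = refl
  any-true⁺ {y ∷ _} (there m) px with p y
  ... | true  = refl
  ... | false = any-true⁺ m px

  any-true⁻ : ∀ xs → any p xs ≡ true → ∃[ x ] (x ∈ xs × p x ≡ true)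
  any-true⁻ (x ∷ xs) h with p x in eq
  ... | true  = x , here refl , eq
  ... | false = let y , m , py = any-true⁻ xs h in y , there m , py

module _ {n : ℕ} where

  inFaults⁺ : ∀ {F : FaultSet n} {e u v} → e ∈ F → Link e u v → inFaults F u v ≡ true
  inFaults⁺ {e = e@(_ , _)} m l = any-true⁺ m (linkᵇ⁺ e l)

  inFaults⁻ : ∀ (F : FaultSet n) {u v} → inFaults F u v ≡ true → ∃[ e ] (e ∈ F × Link e u v)
  inFaults⁻ F h with any-true⁻ F h
  ... | e@(_ , _) , m , l = e , m , linkᵇ⁻ e l

  module _ (G : Graph n) where

    Avoids : FaultSet n → Fin n → Fin n → Set
    Avoids F u v = ∀ {e} → e ∈ F → ¬ Link e u v

    adjMinus⁺ : ∀ {F u v} → adj G u v ≡ true → Avoids F u v → adjMinus G F u v ≡ true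
    adjMinus⁺ {F} {u} {v} a free rewrite a with inFaults F u v in eq
    ... | false = refl
    ... | true  = let e , m , l = inFaults⁻ F eq in ⊥-elim (free m l)

    adjMinus⁻ : ∀ {F u v} → adjMinus G F u v ≡ true → adj G u v ≡ true × Avoids F u v
    adjMinus⁻ {F} {u} {v} h with adj G u v | inFaults F u v in eq
    ... | true  | false = refl , λ m l → case (trans (sym eq) (inFaults⁺ m l))
      where
      case : ∀ {A : Set} → false ≡ true → A
      case ()
    adjMinus⁻ () | true  | true
    adjMinus⁻ () | false | _

    adjMinus-sym : ∀ {F u v} → adjMinus G F u v ≡ true → adjMinus G F v u ≡ true
    adjMinus-sym {F} {u} {v} h with adjMinus⁻ {F} h
    ... | a , free = adjMinus⁺ {F} (trans (Graph.sym G v u) a) λ m → free m ∘ link-sym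

    adjMinus-antitone : ∀ {F F′} → (∀ {e} → e ∈ F → e ∈ F′) →
                        ∀ u v → adjMinus G F′ u v ≡ true → adjMinus G F u v ≡ true
    adjMinus-antitone {F} {F′} F⊆ u v h with adjMinus⁻ {F′} h
    ... | a , free = adjMinus⁺ {F} a λ m → free (F⊆ m)

    adjMinus-++ : ∀ R {F u v} → adjMinus G F u v ≡ true → Avoids R u v → adjMinus G (R ++ F) u v ≡ true
    adjMinus-++ R {F} {u} {v} a free with adjMinus⁻ {F} a
    ... | a′ , free′ = adjMinus⁺ {R ++ F} a′ λ m → cases (∈-++⁻ R m)
      where
      cases : ∀ {e} → e ∈ R ⊎ e ∈ F → ¬ Link e u v
      cases (inj₁ m) = free m
      cases (inj₂ m) = free′ m

    -- Stopping at the first arc in `R` leaves a prefix free of all of `R`; `far-safe` depends on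
    -- this.
    first-use : ∀ R F {v xs s} → Path (adjMinus G F) v xs s → Path (adjMinus G (R ++ F)) v xs s ⊎
                ∃[ pre ] ∃[ z ] ∃[ z′ ] ∃[ post ] (xs ≡ pre ++ z′ ∷ post × Path (adjMinus G (R ++ F)) v pre z ×
                                                   ∃[ e ] (e ∈ R × Link e z z′))
    first-use R F [] = inj₁ []
    first-use R F {v} (_∷_ {u = u} a p) with inFaults R v u in eq
    ... | true = inj₂ ([] , v , u , _ , refl , [] , inFaults⁻ R eq)
    ... | false with adjMinus-++ R {F} a (λ m l → case (trans (sym eq) (inFaults⁺ m l))) | first-use R F p
      where
      case : false ≡ true → ⊥
      case ()
    ...   | arc | inj₁ q = inj₁ (arc ∷ q)
    ...   | arc | inj₂ (pre , z , z′ , post , refl , q , l) = inj₂ (u ∷ pre , z , z′ , post , refl , arc ∷ q , l)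

-- Restoration after one fault

path-end : ∀ {n} {A B : Adjacency n} {v xs m m′} → Path A v xs m → Path B v xs m′ → m ≡ m′
path-end []      []      = refl
path-end (_ ∷ p) (_ ∷ q) = path-end p q

path-tail : ∀ {n} {A : Adjacency n} {v u xs s} → Path A v (u ∷ xs) s → Path A u xs s
path-tail (_ ∷ p) = p

path-drop : ∀ {n} {A B : Adjacency n} {v} xs {ys m s} → Path A v (xs ++ ys) s → Path B v xs m → Path A m ys s
path-drop xs p q with path-split xs p
... | m , r , t rewrite path-end q r = t

path-reverse : ∀ {n} {A : Adjacency n} → (∀ {u v} → A u v ≡ true → A v u ≡ true) →
               ∀ {v xs s} → Path A v xs s → ∃[ ys ] (Path A s ys v × length ys ≡ length xs)
path-reverse A-sym [] = [] , [] , refl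
path-reverse A-sym {v} (_∷_ {u = u} a p) with path-reverse A-sym p
... | ys , q , eq = ys ++ v ∷ [] , path-++ q (A-sym a ∷ []) ,
      trans (length-++ ys) (trans (+-comm (length ys) 1) (cong suc eq))

module Restoration {n : ℕ} (G : Graph n) where

  open Weights n

  -- The vertex list alone fixes where a prefix ends, so the end may be known from a path in a
  -- different graph `B`.
  min-suffix′ : ∀ {A B v} xs {ys m s} → IsMin A v (xs ++ ys) s → Path B v xs m → IsMin A m ys s
  min-suffix′ xs mn q with min-suffix xs mn
  ... | m , r , mn′ rewrite path-end q r = mn′

  min-prefix′ : ∀ {A B v} xs {ys m s} → IsMin A v (xs ++ ys) s → Path B v xs m → IsMin A v xs m
  min-prefix′ xs mn q with min-prefix xs mn
  ... | m , mn′ , _ rewrite path-end q (proj₁ mn′) = mn′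

  module _ (e : Fin n × Fin n) (F : FaultSet n) where

    private
      A = adjMinus G F
      A⁻ = adjMinus G (e ∷ F)

      weaken : ∀ {v xs s} → Path A⁻ v xs s → Path A v xs s
      weaken = path-mono (adjMinus-antitone G {F} {e ∷ F} there)

      A-reverse : ∀ {v xs s} → Path A v xs s → ∃[ ys ] (Path A s ys v × length ys ≡ length xs)
      A-reverse = path-reverse (adjMinus-sym G {F})

      -- A shortest path ending in s can cross e in one direction only.
      same-direction : ∀ {a b a′ b′ xs ys s} → Link e b a → Link e b′ a′ →
                       IsMin A b (a ∷ xs) s → IsMin A b′ (a′ ∷ ys) s → b′ ≡ b × a′ ≡ a
      same-direction l l′ m m′ with link-two l l′
      ... | inj₁ eqs = eqs
      ... | inj₂ (refl , refl) = ⊥-elim (<-irrefl refl (<-trans (min-length m (path-tail (proj₁ m′))) (min-length m′ (path-tail (proj₁ m)))))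

      -- The minimal paths to `s` from `t` and from `y` cross `e` in the same direction, from `b` to
      -- `a`. If the minimal path from `x` to `t` did so too, each end of `e` would be nearer to `t`
      -- than the other. If it went from `a` to `b`, exchange its tail with that of the path from
      -- `y`, starting both new paths at `x`: two opposite crossings of `e`, of weight `M + M`, are
      -- saved, and the two arcs between `x` and `y`, also `M + M`, are added. Since `detour` is
      -- strict, this is impossible.
      crossing : ∀ {s t x y ys pre-t b a post-t pre-y b′ a′ post-y pre-x c c′ post-x} →
        A x y ≡ true → A⁻ y x ≡ true →
        IsMin A x ys s → Path A⁻ x ys s →
        IsMin A t (pre-t ++ a ∷ post-t) s → Path A⁻ t pre-t b → Link e b a →
        IsMin A y (pre-y ++ a′ ∷ post-y) s → Path A⁻ y pre-y b′ → Link e b′ a′ →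
        IsMin A x (pre-x ++ c′ ∷ post-x) t → Path A⁻ x pre-x c → Link e c c′ → ⊥
      crossing {s} {t} {x} {y} {ys} {pre-t} {b} {a} {post-t} {pre-y} {b′} {a′} {post-y} {pre-x} {c} {c′} {post-x}
        xy yx mx avoid mt pt lt my py ly mz pz lz
        with same-direction lt ly (min-suffix′ pre-t mt pt) (min-suffix′ pre-y my py) | link-two lt lz
      ... | refl , refl | inj₁ (refl , refl) = <-irrefl refl (<-trans far-t near-t)
        where
        far-t : length post-x < length pre-t
        far-t with A-reverse (weaken pt)
        ... | zs , q , eq = subst (length (a ∷ post-x) ≤_) eq (min-length (min-suffix′ pre-x mz pz) q)

        near-t : length pre-t < length post-x
        near-t with path-drop pre-x (proj₁ mz) pz | path-drop pre-t (proj₁ mt) pt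
        ... | _ ∷ q | ba ∷ _ with A-reverse q
        ...   | zs , r , eq = begin-strict
                length pre-t                     <⟨ n<1+n _ ⟩
                suc (length pre-t)               ≡⟨ +-comm 1 _ ⟩
                length pre-t + 1                 ≡⟨ length-++ pre-t ⟨
                length (pre-t ++ a ∷ [])         ≤⟨ min-length (min-prefix′ (pre-t ++ a ∷ [])
                                                      (subst (λ zs → IsMin A t zs s) (sym (++-assoc pre-t (a ∷ []) post-t)) mt)
                                                      (path-++ (weaken pt) (ba ∷ []))) r ⟩
                length zs                        ≡⟨ eq ⟩
                length post-x                    ∎
          where open ≤-Reasoning
      ... | refl , refl | inj₂ (refl , refl) = <-irrefl refl total
        where
        open ≤-Reasoning
        W = weight

        -- Strict by uniqueness: the path from `y` through `x` avoids `e`, whereas the minimal path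
        -- from `y` crosses it.
        detour : cost y (pre-y ++ a ∷ post-y) < W y x + cost x ys
        detour = ≤∧≢⇒< (proj₂ my (x ∷ ys) (A-arc ∷ proj₁ mx)) differ
          where
          A-arc : A y x ≡ true
          A-arc = adjMinus-sym G {F} xy
          differ : cost y (pre-y ++ a ∷ post-y) ≢ W y x + cost x ys
          differ eq with min-unique my (A-arc ∷ proj₁ mx , λ zs q → subst (_≤ cost y zs) eq (proj₂ my zs q))
          ... | eq′ with path-drop pre-y (subst (λ zs → Path A⁻ y zs s) (sym eq′) (yx ∷ avoid)) py
          ...   | arc ∷ _ = proj₂ (adjMinus⁻ G {e ∷ F} arc) (here refl) ly

        via-a : cost x ys ≤ cost x pre-x + cost a post-y
        via-a with path-drop pre-y (proj₁ my) py
        ... | _ ∷ q = ≤-trans (proj₂ mx (pre-x ++ post-y) (path-++ (weaken pz) q))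
                              (≤-reflexive (cost-++ post-y pz))

        via-b : cost x (pre-x ++ b ∷ post-x) ≤ W x y + (cost y pre-y + cost b post-x)
        via-b with path-drop pre-x (proj₁ mz) pz
        ... | _ ∷ q = ≤-trans (proj₂ mz (y ∷ pre-y ++ post-x) (xy ∷ path-++ (weaken py) q))
                              (≤-reflexive (cong (W x y +_) (cost-++ post-x py)))

        rest = cost y pre-y + cost a post-y + (cost x pre-x + cost b post-x)

        total : M + M + rest < M + M + rest
        total = begin-strict
          M + M + rest
            ≡⟨ cong (_+ rest) (weight-antisym b a) ⟨
          W b a + W a b + rest
            ≡⟨ shuffle (W b a) (W a b) (cost y pre-y) (cost a post-y) (cost x pre-x) (cost b post-x) ⟩
          (cost y pre-y + (W b a + cost a post-y)) + (cost x pre-x + (W a b + cost b post-x))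
            ≡⟨ cong₂ _+_ (cost-++ (a ∷ post-y) py) (cost-++ (b ∷ post-x) pz) ⟨
          cost y (pre-y ++ a ∷ post-y) + cost x (pre-x ++ b ∷ post-x)
            <⟨ +-mono-<-≤ detour via-b ⟩
          W y x + cost x ys + (W x y + (cost y pre-y + cost b post-x))
            ≤⟨ +-monoˡ-≤ _ (+-monoʳ-≤ (W y x) via-a) ⟩
          W y x + (cost x pre-x + cost a post-y) + (W x y + (cost y pre-y + cost b post-x))
            ≡⟨ shuffle′ (W y x) (W x y) (cost x pre-x) (cost a post-y) (cost y pre-y) (cost b post-x) ⟩
          W y x + W x y + rest
            ≡⟨ cong (_+ rest) (weight-antisym y x) ⟩
          M + M + rest ∎
          where
          shuffle : ∀ u v p q r t → u + v + (p + q + (r + t)) ≡ (p + (u + q)) + (r + (v + t))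
          shuffle = solve-∀
          shuffle′ : ∀ u v r q p t → u + (r + q) + (v + (p + t)) ≡ u + v + (p + q + (r + t))
          shuffle′ = solve-∀

    -- x is the vertex of the given walk right before the minimal paths to s start using e.
    restoration : ∀ {s t xs} → Path A⁻ s xs t →
      ∃[ x ] ∃[ ys ] ∃[ zs ] (IsMin A x ys s × Path A⁻ x ys s × IsMin A x zs t × Path A⁻ x zs t ×
                              length ys + length zs ≤ length xs)
    restoration {s} {t} {xs} p with path-reverse (adjMinus-sym G {e ∷ F}) p
    ... | ps , p′ , eq with ∃-min (weaken p′)
    ...   | ws , mt with first-use G (e ∷ []) F (proj₁ mt)
    ...     | inj₁ good = t , ws , [] , mt , good , ([] , λ _ _ → z≤n) , [] ,
                ≤-trans (≤-reflexive (+-identityʳ _)) (≤-trans (min-length mt (weaken p′)) (≤-reflexive eq))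
    ...     | inj₂ (pre-t , b , a , post-t , refl , pt , _ , here refl , lt) =
                scan p [] ([] , λ _ _ → z≤n) []
      where
      -- Invariant: `back` retraces the walk from `x` to `s`, and the minimal path from `x` to `s`
      -- avoids `e`. At the first arc from `x` to a `y` where this fails, `crossing` forces the
      -- minimal path from `x` to `t` to avoid `e`.
      scan : ∀ {x rest back ys} → Path A⁻ x rest t → Path A⁻ x back s → IsMin A x ys s → Path A⁻ x ys s →
        ∃[ x ] ∃[ ys ] ∃[ zs ] (IsMin A x ys s × Path A⁻ x ys s × IsMin A x zs t × Path A⁻ x zs t ×
                                length ys + length zs ≤ length back + length rest)
      scan {ys = ys} [] back m good =
        t , ys , [] , m , good , ([] , λ _ _ → z≤n) , [] , +-monoˡ-≤ 0 (min-length m (weaken back))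
      scan {x} {y ∷ rest} {back} {ys} (xy ∷ r) bk m good with ∃-min (weaken (adjMinus-sym G {e ∷ F} xy ∷ bk))
      ... | vs , my with first-use G (e ∷ []) F (proj₁ my)
      ...   | inj₁ good′ with scan r (adjMinus-sym G {e ∷ F} xy ∷ bk) my good′
      ...     | x′ , ys′ , zs′ , a₁ , a₂ , a₃ , a₄ , le =
                  x′ , ys′ , zs′ , a₁ , a₂ , a₃ , a₄ , ≤-trans le (≤-reflexive (sym (+-suc (length back) (length rest))))
      scan {x} {y ∷ rest} {back} {ys} (xy ∷ r) bk m good | vs , my | inj₂ (pre-y , b′ , a′ , post-y , refl , py , _ , here refl , ly)
        with ∃-min (weaken (xy ∷ r))
      ... | zs , mz with first-use G (e ∷ []) F (proj₁ mz)
      ...   | inj₁ good-z = x , ys , zs , m , good , mz , good-z ,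
                  +-mono-≤ (min-length m (weaken bk)) (min-length mz (weaken (xy ∷ r)))
      ...   | inj₂ (pre-x , c , c′ , post-x , refl , pz , _ , here refl , lz) =
                  ⊥-elim (crossing (adjMinus-antitone G {F} {e ∷ F} there x y xy) (adjMinus-sym G {e ∷ F} xy)
                            m good mt pt lt my py ly mz pz lz)

-- Counting next hops

near-factor : ℕ → ℕ
near-factor zero    = 1
near-factor (suc k) = 1 + suc k * (2 * near-factor k)

-- One summand per level j < g: the outer 2 because a sample serves only half of the arcs, the inner
-- 2 because it has up to 2n / x^(2^j) vertices.
far-factor : ℕ → ℕ
far-factor zero    = 0
far-factor (suc g) = far-factor g + 2 * (near-factor g * 2 + far-factor g)

hop-factor : ℕ → ℕ → ℕ
hop-factor g c = near-factor g * c + far-factor g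

∈-removeAt : ∀ {A : Set} {x : A} xs i → x ∈ removeAt xs i → x ∈ xs
∈-removeAt (_ ∷ xs) zero    m           = there m
∈-removeAt (_ ∷ xs) (suc i) (here refl) = here refl
∈-removeAt (_ ∷ xs) (suc i) (there m)   = there (∈-removeAt xs i m)

∈-take-prefix : ∀ {A : Set} {x : A} k xs → x ∈ take k xs →
                ∃₂ λ as bs → xs ≡ (as ++ x ∷ []) ++ bs × length (as ++ x ∷ []) ≤ k
∈-take-prefix (suc k) (x ∷ xs) (here refl) = [] , xs , refl , s≤s z≤n
∈-take-prefix (suc k) (x ∷ xs) (there m) with ∈-take-prefix k xs m
... | as , bs , refl , l = x ∷ as , bs , refl , s≤s l

++-cancel-length : ∀ {A : Set} as bs {x y : A} {xs ys} → as ++ x ∷ xs ≡ bs ++ y ∷ ys → length as ≡ length bs →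
                   as ≡ bs × x ≡ y
++-cancel-length []       []       refl _ = refl , refl
++-cancel-length (a ∷ as) (b ∷ bs) eq   l with ∷-injective eq
... | refl , eq′ with ++-cancel-length as bs eq′ (suc-injective l)
...   | refl , x≡y = refl , x≡y

path-∷ʳ-end : ∀ {n} {A : Adjacency n} {v} xs {u s} → Path A v (xs ++ u ∷ []) s → u ≡ s
path-∷ʳ-end []       (_ ∷ []) = refl
path-∷ʳ-end (_ ∷ xs) (_ ∷ p)  = path-∷ʳ-end xs p

module Hops {n : ℕ} (G : Graph n) (v : Fin n) (x : ℕ) (1≤x : 1 ≤ x) where

  open Weights n
  open Restoration G
  open import Data.List.Membership.DecPropositional (_≟_ {n}) using (_∈?_)

  A : FaultSet n → Adjacency n
  A = adjMinus G

  Hop : FaultSet n → Fin n → Fin n → Set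
  Hop F s u = ∃[ xs ] IsMin (A F) v (u ∷ xs) s

  HopWithin : ℕ → Fin n → Fin n → Set
  HopWithin g s u = ∃[ F ] (length F ≤ g × Hop F s u)

  IsMin-antitone : ∀ {F F′ xs s} → (∀ {e} → e ∈ F → e ∈ F′) → IsMin (A F) v xs s → Path (A F′) v xs s →
                   IsMin (A F′) v xs s
  IsMin-antitone F⊆ (_ , min) p = p , λ ys q → min ys (path-mono (adjMinus-antitone G F⊆) q)

  radius : ℕ → ℕ
  radius j = x ^ (2 ^ j)

  1≤radius : ∀ j → 1 ≤ radius j
  1≤radius j = m^n>0 x {{>-nonZero 1≤x}} (2 ^ j)

  radii : List ℕ → ℕ
  radii T = product (map radius T)

  1≤radii : ∀ T → 1 ≤ radii T
  1≤radii []      = ≤-refl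
  1≤radii (j ∷ T) = *-mono-≤ (1≤radius j) (1≤radii T)

  radii-removeAt : ∀ T i → radius (lookup T i) * radii (removeAt T i) ≡ radii T
  radii-removeAt (j ∷ T) zero    = refl
  radii-removeAt (j ∷ T) (suc i) = trans (swap (radius (lookup T i)) (radius j) _)
                                         (cong (radius j *_) (radii-removeAt T i))
    where
    swap : ∀ a b c → a * (b * c) ≡ b * (a * c)
    swap = solve-∀

  -- The purpose of the doubled exponents: n / `radius g` targets with this many choices each make n
  -- / `x` choices.
  radii-downFrom : ∀ g → radii (downFrom g) * x ≡ x ^ (2 ^ g)
  radii-downFrom zero    = trans (*-identityˡ x) (sym (*-identityʳ x))
  radii-downFrom (suc g) = begin
    radius g * radii (downFrom g) * x   ≡⟨ *-assoc (radius g) _ x ⟩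
    radius g * (radii (downFrom g) * x) ≡⟨ cong (radius g *_) (radii-downFrom g) ⟩
    x ^ (2 ^ g) * x ^ (2 ^ g)           ≡⟨ ^-distribˡ-+-* x (2 ^ g) (2 ^ g) ⟨
    x ^ (2 ^ g + 2 ^ g)                 ≡⟨ cong (λ k → x ^ (2 ^ g + k)) (sym (+-identityʳ (2 ^ g))) ⟩
    x ^ (2 ^ suc g)                     ∎
    where open ≡-Reasoning

  ArcAt : FaultSet n → Fin n → ℕ → Fin n × Fin n → Set
  ArcAt F s a (z , z′) = ∃[ pre ] ∃[ post ] (IsMin (A F) v (pre ++ z′ ∷ post) s × Path (A F) v pre z × length pre ≡ a)

  -- Since minimal paths are unique, naming a fault on one costs only a position, not a pair of
  -- vertices.
  ArcAt-unique : ∀ {F s a e e′} → ArcAt F s a e → ArcAt F s a e′ → e ≡ e′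
  ArcAt-unique (pre , post , m , p , l) (pre′ , post′ , m′ , p′ , l′)
    with ++-cancel-length pre pre′ (min-unique m m′) (trans l (sym l′))
  ... | refl , refl = cong (_, _) (path-end p p′)

  orientations : Fin n × Fin n → List (Fin n × Fin n)
  orientations (z , z′) = (z , z′) ∷ (z′ , z) ∷ []

  link⇒orientation : ∀ {e z z′} → Link e z z′ → e ∈ orientations (z , z′)
  link⇒orientation (inj₁ eq) = here eq
  link⇒orientation (inj₂ eq) = there (here eq)

  -- Next hops after inserting faults one by one, each within an unused radius of v on the current minimal path.
  Near : ℕ → Fin n → FaultSet n → List ℕ → Fin n → Set
  Near zero    s F T u = Hop F s u
  Near (suc k) s F T u = Hop F s u ⊎
    ∃[ i ] (i ∈ allFin (length T) × ∃[ a ] (a ∈ upTo (radius (lookup T i)) ×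
      ∃[ arc ] (ArcAt F s a arc × ∃[ e ] (e ∈ orientations arc × Near k s (e ∷ F) (removeAt T i) u))))

  Hop-count : ∀ F s → AtMost (Hop F s) 1 1
  Hop-count F s = AtMost-unique λ (_ , m) (_ , m′) → min-first m m′

  -- Every inserted fault uses up one radius and has that many possible positions, so the radii
  -- multiply; the order in which they are used enters `near-factor`.
  Near-count : ∀ k s F T → length T ≡ k → AtMost (Near k s F T) 1 (near-factor k * radii T)
  Near-count zero    s F T eq = AtMost-≤ (≤-trans (1≤radii T) (≤-reflexive (sym (*-identityˡ _)))) (Hop-count F s)
  Near-count (suc k) s F T eq =
    AtMost-≤ branches (AtMost-⊎ (Hop-count F s)
      (AtMost-⋃ (allFin (length T)) λ i _ →
        AtMost-≤ (≤-reflexive (size i)) (AtMost-⋃ (upTo (radius (lookup T i))) λ a _ →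
          AtMost-functional (ArcAt-unique {F}) λ arc _ → AtMost-⋃ (orientations arc) λ e _ →
            Near-count k s (e ∷ F) (removeAt T i) (suc-injective (trans (sym (length-removeAt′ T i)) eq)))))
    where
    size : ∀ i → length (upTo (radius (lookup T i))) * (2 * (near-factor k * radii (removeAt T i))) ≡
                 2 * near-factor k * radii T
    size i = trans (cong (_* (2 * (near-factor k * radii (removeAt T i)))) (length-upTo (radius (lookup T i))))
             (trans (shuffle (radius (lookup T i)) (near-factor k) (radii (removeAt T i)))
                    (cong (2 * near-factor k *_) (radii-removeAt T i)))
      where
      shuffle : ∀ r b t → r * (2 * (b * t)) ≡ 2 * b * (r * t)
      shuffle = solve-∀

    branches : 1 + length (allFin (length T)) * (2 * near-factor k * radii T) ≤ near-factor (suc k) * radii T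
    branches = +-mono-≤ (1≤radii T) (≤-reflexive (trans
      (cong (_* (2 * near-factor k * radii T)) (trans (length-tabulate {n = length T} (λ i → i)) eq))
      (sym (*-assoc (suc k) (2 * near-factor k) (radii T)))))

  -- A hop with this many targets is caught by a sparse sample of targets, and under `j` faults
  -- only, so that the count recurses.
  Far : ℕ → Fin n → Set
  Far j u = ∃[ rs ] (Unique rs × length rs ≡ radius j × All (λ r → HopWithin j r u) rs)

  -- Within radius j of v, the faults Q ∪ R have the same effect as F ∪ R.
  Safe : FaultSet n → FaultSet n → FaultSet n → ℕ → Set
  Safe Q F R j = ∀ xs r → length xs ≤ radius j → Path (A (R ++ Q)) v xs r → Path (A (R ++ F)) v xs r

  -- Q ∪ R are the faults still relevant within radius j; p counts the unused radii listed before j.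
  data Budget (F R : FaultSet n) : ℕ → List ℕ → Set where
    []  : ∀ {p} → Budget F R p []
    _∷_ : ∀ {p j T} → (∃[ Q ] ((∀ {e} → e ∈ Q → e ∈ F) × Safe Q F R j × length Q + length R ≤ suc j + p)) →
          Budget F R (suc p) T → Budget F R p (j ∷ T)

  -- One insertion: `F` holds the faults inserted so far, and the minimal path under `F` crosses the
  -- pending fault `e` after `length pre` arcs.
  module Insert (s : Fin n) (F : FaultSet n) {pre z z′ post} (ρ : IsMin (A F) v (pre ++ z′ ∷ post) s)
                (pre-path : Path (A F) v pre z) (e : Fin n × Fin n) (link : Link e z z′) (as bs : FaultSet n) where

    R R⁻ F⁺ : FaultSet n
    R  = as ++ e ∷ bs
    R⁻ = as ++ bs
    F⁺ = e ∷ F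

    moved : ∀ {X} {c} → c ∈ R ++ X → c ∈ R⁻ ++ e ∷ X
    moved {X} m with ∈-++⁻ R m
    ... | inj₂ i = ∈-++⁺ʳ R⁻ (there i)
    ... | inj₁ i with ∈-++⁻ as i
    ...   | inj₁ h          = ∈-++⁺ˡ (∈-++⁺ˡ h)
    ...   | inj₂ (here eq)  = ∈-++⁺ʳ R⁻ (here eq)
    ...   | inj₂ (there h)  = ∈-++⁺ˡ (∈-++⁺ʳ as h)

    moved⁻ : ∀ {X} {c} → c ∈ R⁻ ++ e ∷ X → c ∈ R ++ X
    moved⁻ {X} m with ∈-++⁻ R⁻ m
    ... | inj₂ (here eq) = ∈-++⁺ˡ (∈-++⁺ʳ as (here eq))
    ... | inj₂ (there i) = ∈-++⁺ʳ R i
    ... | inj₁ i with ∈-++⁻ as i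
    ...   | inj₁ h = ∈-++⁺ˡ (∈-++⁺ˡ h)
    ...   | inj₂ h = ∈-++⁺ˡ (∈-++⁺ʳ as (there h))

    moved-front⁻ : ∀ {X} {c} → c ∈ R ++ X → c ∈ (e ∷ []) ++ R⁻ ++ X
    moved-front⁻ {X} m with ∈-++⁻ R⁻ (moved {X} m)
    ... | inj₁ i         = there (∈-++⁺ˡ i)
    ... | inj₂ (here eq) = here eq
    ... | inj₂ (there i) = there (∈-++⁺ʳ R⁻ i)

    length-R : length R ≡ suc (length R⁻)
    length-R = length-insert e as

    a : ℕ
    a = length pre

    -- For radii listed before the charged one: `e` may lie within them, so it moves from `R` to `Q`
    -- and the total stays the same.
    near : ∀ {j p} → (∃[ Q ] ((∀ {e} → e ∈ Q → e ∈ F) × Safe Q F R j × length Q + length R ≤ suc j + p)) →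
           ∃[ Q ] ((∀ {c} → c ∈ Q → c ∈ F⁺) × Safe Q F⁺ R⁻ j × length Q + length R⁻ ≤ suc j + p)
    near (Q , Q⊆F , safe , l) = e ∷ Q , (λ { (here eq) → here eq ; (there m) → there (Q⊆F m) }) ,
      (λ xs r lx p → path-mono (adjMinus-antitone G moved⁻) (safe xs r lx (path-mono (adjMinus-antitone G moved) p))) ,
      ≤-trans (≤-reflexive (trans (sym (+-suc (length Q) _)) (cong (length Q +_) (sym length-R)))) l

    -- A short path through e would reach an end of e faster than the minimal path does.
    far-safe : ∀ {Q j} → radius j ≤ a → Safe Q F R j → Safe Q F⁺ R⁻ j
    far-safe {Q} {j} far safe xs r lx p with first-use G (e ∷ []) (R⁻ ++ Q) p
    ... | inj₁ q = path-mono (adjMinus-antitone G moved⁻)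
                     (safe xs r lx (path-mono (adjMinus-antitone G (moved-front⁻ {Q})) q))
    ... | inj₂ (w , y , y′ , ws , refl , q , _ , here refl , l) = ⊥-elim (absurd (link-two link l))
      where
      short : length w < radius j
      short = <-≤-trans (subst (length w <_) (sym (length-++ w)) (m<m+n _ (s≤s z≤n))) lx

      w-path : Path (A F) v w y
      w-path = path-mono (adjMinus-antitone G (∈-++⁺ʳ R))
                 (safe w y (<⇒≤ short) (path-mono (adjMinus-antitone G (moved-front⁻ {Q})) q))

      absurd : (y ≡ z × y′ ≡ z′) ⊎ (y ≡ z′ × y′ ≡ z) → ⊥
      absurd (inj₁ (refl , refl)) = <⇒≱ short (≤-trans far (min-length (min-prefix′ pre ρ pre-path) w-path))
      absurd (inj₂ (refl , refl)) with path-drop pre (proj₁ ρ) pre-path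
      ... | zz′ ∷ _ = <⇒≱ short (≤-trans far (≤-trans (subst (a ≤_) (sym (length-++ pre)) (m≤m+n a 1))
              (min-length (min-prefix′ (pre ++ z′ ∷ []) (subst (λ ys → IsMin (A F) v ys s) (sym (++-assoc pre (z′ ∷ []) post)) ρ)
                            (path-++ pre-path (zz′ ∷ []))) w-path)))

    -- For radii listed after the charged one: `e` lies beyond them and leaves `R` without entering
    -- `Q`. The total drops by one, as does `p`, since the charged radius is used up.
    far : ∀ {p T} → All (λ j → radius j ≤ a) T → Budget F R (suc p) T → Budget F⁺ R⁻ p T
    far [] [] = []
    far {p} (f ∷ fs) (_∷_ {j = j} (Q , Q⊆F , safe , l) b) =
      (Q , there ∘ Q⊆F , far-safe {Q} {j} f safe , far-budget l) ∷ far fs b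
      where
      far-budget : length Q + length R ≤ suc j + suc p → length Q + length R⁻ ≤ suc j + p
      far-budget l = s≤s⁻¹ (≤-trans (≤-reflexive (trans (sym (+-suc (length Q) _)) (cong (length Q +_) (sym length-R))))
                            (≤-trans l (≤-reflexive (+-suc (suc j) p))))

    -- The fault is charged to the last radius that exceeds its distance from v.
    charge : ∀ {p T} → Budget F R p T →
             (∃[ i ] (a < radius (lookup T i) × Budget F⁺ R⁻ p (removeAt T i))) ⊎ All (λ j → radius j ≤ a) T
    charge [] = inj₂ []
    charge {p} {j ∷ T} (q ∷ b) with charge b
    ... | inj₁ (i , a< , b′) = inj₁ (suc i , a< , near {j} {p} q ∷ b′)
    ... | inj₂ fs with a <? radius j
    ...   | yes a< = inj₁ (zero , a< , far fs b)
    ...   | no  a≥ = inj₂ (≮⇒≥ a≥ ∷ fs)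

    -- The first `radius j` vertices of the path become the targets. Within that radius a path
    -- avoiding `N`, at most `j` faults, avoids all of `R ++ F`, so each prefix remains minimal
    -- under `N`.
    far-hop : ∀ {j u} → radius j ≤ a → ∃[ Q ] ((∀ {c} → c ∈ Q → c ∈ F) × Safe Q F R j × length Q + length R ≤ suc j + 0) →
              Hop (R ++ F) s u → Far j u
    far-hop {j} {u} a≥ (Q , Q⊆F , safe , l) (xs , m) =
      take (radius j) (u ∷ xs) , Unique.take⁺ (radius j) (drop-head (min-Unique m)) ,
      trans (length-take (radius j) (u ∷ xs)) (m≤n⇒m⊓n≡m long) , All.tabulate hop
      where
      drop-head : ∀ {y : Fin n} {ys} → Unique (y ∷ ys) → Unique ys
      drop-head = Unique.drop⁺ 1

      -- The path under `F` is minimal for fewer faults, hence no longer, and it already reaches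
      -- `radius j`.
      long : radius j ≤ length (u ∷ xs)
      long = begin
        radius j                   ≤⟨ a≥ ⟩
        length pre                 ≤⟨ m≤m+n _ _ ⟩
        length pre + suc (length post) ≡⟨ length-++ pre ⟨
        length (pre ++ z′ ∷ post)  ≤⟨ min-length ρ (path-mono (adjMinus-antitone G (∈-++⁺ʳ R)) (proj₁ m)) ⟩
        length (u ∷ xs)            ∎
        where open ≤-Reasoning

      N = R⁻ ++ Q

      safe⁻ : Safe Q F⁺ R⁻ j
      safe⁻ = far-safe {Q} {j} a≥ safe

      few : length N ≤ j
      few = ≤-trans (≤-reflexive (trans (length-++ R⁻) (+-comm (length R⁻) _)))
            (s≤s⁻¹ (≤-trans (≤-reflexive (trans (sym (+-suc (length Q) _)) (cong (length Q +_) (sym length-R))))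
                     (≤-trans l (≤-reflexive (+-identityʳ (suc j))))))

      N⊆ : ∀ {c} → c ∈ N → c ∈ R ++ F
      N⊆ {c} i with ∈-++⁻ R⁻ i
      ... | inj₁ h = moved⁻ {F} (∈-++⁺ˡ h)
      ... | inj₂ h = ∈-++⁺ʳ R (Q⊆F h)

      start : ∀ {r} as {bs} → u ∷ xs ≡ (as ++ r ∷ []) ++ bs → ∃[ ys ] (as ++ r ∷ [] ≡ u ∷ ys)
      start []       refl = [] , refl
      start (_ ∷ as) refl = as ++ _ ∷ [] , refl

      hop : ∀ {r} → r ∈ take (radius j) (u ∷ xs) → HopWithin j r u
      hop {r} i with ∈-take-prefix (radius j) (u ∷ xs) i
      ... | ws , bs , eq , lw with start ws eq | min-prefix (ws ++ r ∷ []) (subst (λ ys → IsMin (A (R ++ F)) v ys s) eq m)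
      ...   | ys , eq′ | r′ , mn , _ with path-∷ʳ-end ws (proj₁ mn)
      ...     | refl = N , few , ys , subst (λ zs → IsMin (A N) v zs r) eq′ (inN , minimal)
        where
        inN : Path (A N) v (ws ++ r ∷ []) r
        inN = path-mono (adjMinus-antitone G N⊆) (proj₁ mn)

        minimal : ∀ zs → Path (A N) v zs r → cost v (ws ++ r ∷ []) ≤ cost v zs
        minimal zs q with ∃-min q
        ... | ts , mt = ≤-trans (proj₂ mn ts (path-mono (adjMinus-antitone G (moved {F}))
                          (safe⁻ ts r (≤-trans (min-length mt inN) lw) (proj₁ mt)))) (proj₂ mt zs q)

  -- Induction on `k`, with `R` the pending faults. A minimal path under `F` that avoids `R` is
  -- minimal under `R ++ F`. Otherwise a pending fault on it is charged to a radius; if no radius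
  -- exceeds its distance, the head of `T`, where `p = 0`, leaves at most `j` relevant faults.
  near-or-far : ∀ k s F R T {u} → length T ≡ k → length R ≤ k → Budget F R 0 T → Hop (R ++ F) s u →
                Near k s F T u ⊎ ∃[ j ] (j ∈ T × Far j u)
  near-or-far k s F R T {u} eq lR budget (xs , m) with ∃-min (path-mono (adjMinus-antitone G (∈-++⁺ʳ R)) (proj₁ m))
  ... | ys , ρ with first-use G R F (proj₁ ρ)
  ...   | inj₁ q = inj₁ (stop k (xs , path-mono (adjMinus-antitone G (∈-++⁺ʳ R)) (proj₁ m) ,
                                 λ zs z → ≤-trans (proj₂ m ys q) (proj₂ ρ zs z)))
    where
    stop : ∀ k → Hop F s u → Near k s F T u
    stop zero    h = h
    stop (suc k) h = inj₁ h
  ...   | inj₂ (pre , z , z′ , post , refl , p , e , e∈R , link) with ∈-∃++ e∈R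
  ...     | as , bs , refl = insert k eq lR budget
    where
    open Insert s F ρ (path-mono (adjMinus-antitone G (∈-++⁺ʳ R)) p) e link as bs hiding (R)
    insert : ∀ k {T} → length T ≡ k → length R ≤ k → Budget F R 0 T → Near k s F T u ⊎ ∃[ j ] (j ∈ T × Far j u)
    insert zero {[]} _ l _ = ⊥-elim (<⇒≱ (subst (0 <_) (sym length-R) (s≤s z≤n)) l)
    insert (suc k) {T} eq l b with charge b
    insert (suc k) {j ∷ T} eq l (q ∷ b) | inj₂ (f ∷ _) = inj₂ (j , here refl , far-hop {j} f q (xs , m))
    ... | inj₁ (i , a< , b′)
        with near-or-far k s F⁺ R⁻ (removeAt T i) (suc-injective (trans (sym (length-removeAt′ T i)) eq))
               (s≤s⁻¹ (subst (_≤ suc k) length-R l)) b′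
               (xs , IsMin-antitone {R ++ F} moved m (path-mono (adjMinus-antitone G moved⁻) (proj₁ m)))
    ...   | inj₂ (j , j∈ , fr) = inj₂ (j , ∈-removeAt T i j∈ , fr)
    ...   | inj₁ nr = inj₁ (inj₂ (i , ∈-allFin i , a , ∈-upTo⁺ a< , (z , z′) ,
                        (pre , post , ρ , path-mono (adjMinus-antitone G (∈-++⁺ʳ R)) p , refl) , e , link⇒orientation link , nr))

  initial-budget : ∀ g p R → length R ≤ g + p → Budget [] R p (downFrom g)
  initial-budget zero    p R l = []
  initial-budget (suc g) p R l = ([] , (λ m → m) , (λ _ _ _ q → q) , l) ∷
    initial-budget g (suc p) R (≤-trans l (≤-reflexive (sym (+-suc g p))))

  -- The density `c` is free because the greedy set of the spanner needs f + 2 and the samples need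
  -- 2.
  Count : ℕ → ℕ → Set
  Count g c = ∀ S → length S * radius g ≤ c * n →
              AtMost (λ u → ∃[ s ] (s ∈ S × HopWithin g s u)) x (hop-factor g c * n)

  -- At least half of the vertices are hops towards a target in the sample, and `Count j 2` applies
  -- to those.
  Far-count : ∀ j → Count j 2 → AtMost (Far j) x (2 * hop-factor j 2 * n)
  Far-count j count us unique fars = bound
    where
    -- Each vertex travels with its evidence, from which `hit` reads the targets.
    items : List (∃ (Far j))
    items = All.toList fars

    toList-proj₁ : ∀ {us} (fs : All (Far j) us) → map proj₁ (All.toList fs) ≡ us
    toList-proj₁ []       = refl
    toList-proj₁ (_ ∷ fs) = cong (_ ∷_) (toList-proj₁ fs)

    hit : Fin n → ∃ (Far j) → Bool
    hit r (_ , rs , _) = ⌊ r ∈? rs ⌋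

    dense : ∀ {i} → i ∈ items → radius j ≤ countᵇ (λ r → hit r i) (allFin n)
    dense {_ , rs , un , len , _} _ = subst (_≤ _) len (≤-trans
      (Unique⇒length≤ un λ {r} m → ∈-filter⁺ _ (∈-allFin r) (member m))
      (≤-reflexive (length-filterTrue _ (allFin n))))
      where
      member : ∀ {r} → r ∈ rs → ⌊ r ∈? rs ⌋ ≡ true
      member {r} m with r ∈? rs
      ... | yes _ = refl
      ... | no ¬m = ⊥-elim (¬m m)

    cover = half-cover hit (allFin n) items (radius j) (1≤radius j) dense
    sample = proj₁ cover

    covered : ∃ (Far j) → Bool
    covered i = 0 <ᵇ countᵇ (λ r → hit r i) sample

    hopWithin : ∀ {r} i → hit r i ≡ true → HopWithin j r (proj₁ i)
    hopWithin {r} (_ , rs , _ , _ , hops) h with r ∈? rs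
    ... | yes m = All.lookup hops m

    witness : ∀ i S → (0 <ᵇ countᵇ (λ r → hit r i) S) ≡ true → ∃[ r ] (r ∈ S × HopWithin j r (proj₁ i))
    witness i (r ∷ S) c with hit r i in eq
    ... | true  = r , here refl , hopWithin {r} i eq
    ... | false = let r′ , m , h = witness i S c in r′ , there m , h

    bound : length us * x ≤ 2 * hop-factor j 2 * n
    bound = begin
      length us * x                             ≡⟨ cong (_* x) (trans (cong length (sym (toList-proj₁ fars))) (length-map proj₁ items)) ⟩
      length items * x                          ≤⟨ *-monoˡ-≤ x (proj₂ (proj₂ cover)) ⟩
      2 * countᵇ covered items * x              ≡⟨ cong (λ k → 2 * k * x) (trans (sym (length-filterTrue covered items)) (sym (length-map proj₁ (filterTrue covered items)))) ⟩
      2 * length (map proj₁ (filterTrue covered items)) * x  ≡⟨ *-assoc 2 (length (map proj₁ (filterTrue covered items))) x ⟩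
      2 * (length (map proj₁ (filterTrue covered items)) * x) ≤⟨ *-monoʳ-≤ 2 (count sample few _ distinct hops) ⟩
      2 * (hop-factor j 2 * n)                  ≡⟨ *-assoc 2 (hop-factor j 2) n ⟨
      2 * hop-factor j 2 * n                    ∎
      where
      open ≤-Reasoning
      few : length sample * radius j ≤ 2 * n
      few = ≤-trans (proj₁ (proj₂ cover)) (≤-reflexive (cong (2 *_) (length-tabulate {n = n} (λ i → i))))
      distinct : Unique (map proj₁ (filterTrue covered items))
      distinct = AllPairs.map⁺ (AllPairs.filter⁺ _ (AllPairs.map⁻ (subst Unique (sym (toList-proj₁ fars)) unique)))
      hops : All (λ u → ∃[ r ] (r ∈ sample × HopWithin j r u)) (map proj₁ (filterTrue covered items))
      hops = All.map⁺ (All.map (λ {i} → witness i sample) (All.all-filter _ items))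

  mutual
    Far<-count : ∀ g → AtMost (λ u → ∃[ j ] (j < g × Far j u)) x (far-factor g * n)
    Far<-count zero [] _ _ = z≤n
    Far<-count zero (_ ∷ _) _ ((_ , () , _) ∷ _)
    Far<-count (suc g) = AtMost-≤ (≤-reflexive (sym (*-distribʳ-+ n (far-factor g) _)))
      (AtMost-⇒ cases (AtMost-⊎ (Far<-count g) (Far-count g (hop-count g 2))))
      where
      cases : ∀ {u} → ∃[ j ] (j < suc g × Far j u) → ∃[ j ] (j < g × Far j u) ⊎ Far g u
      cases (j , s≤s j≤g , f) with m≤n⇒m<n∨m≡n j≤g
      ... | inj₁ j<g  = inj₁ (j , j<g , f)
      ... | inj₂ refl = inj₂ f

    -- Near hops number at most `length S` times the product of the radii, O(n / x) by
    -- `radii-downFrom`; far hops belong to levels below `g`, so the mutual recursion descends.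
    hop-count : ∀ g c → Count g c
    hop-count g c S small = AtMost-≤ size (AtMost-⇒ cases (AtMost-⊎
      (AtMost-scale x (AtMost-⋃ S λ s _ → Near-count g s [] (downFrom g) (length-downFrom g)))
      (Far<-count g)))
      where
      cases : ∀ {u} → ∃[ s ] (s ∈ S × HopWithin g s u) →
              ∃[ s ] (s ∈ S × Near g s [] (downFrom g) u) ⊎ ∃[ j ] (j < g × Far j u)
      cases (s , s∈ , F , l , xs , m) with near-or-far g s [] F (downFrom g) (length-downFrom g) l
          (initial-budget g 0 F (≤-trans l (≤-reflexive (sym (+-identityʳ g)))))
          (xs , IsMin-antitone {F} (λ i → ∈-++⁺ˡ i) m (path-mono (adjMinus-antitone G drop-[]) (proj₁ m)))
        where
        drop-[] : ∀ {c} → c ∈ F ++ [] → c ∈ F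
        drop-[] i with ∈-++⁻ F i
        ... | inj₁ h = h
      ... | inj₁ nr            = inj₁ (s , s∈ , nr)
      ... | inj₂ (j , j∈ , fr) = inj₂ (j , ∈-downFrom⁻ j∈ , fr)

      size : length S * (near-factor g * radii (downFrom g)) * x + far-factor g * n ≤ hop-factor g c * n
      size = begin
        length S * (near-factor g * radii (downFrom g)) * x + far-factor g * n
          ≡⟨ cong (_+ far-factor g * n) (shuffle (length S) (near-factor g) (radii (downFrom g)) x) ⟩
        near-factor g * (length S * (radii (downFrom g) * x)) + far-factor g * n
          ≡⟨ cong (λ k → near-factor g * (length S * k) + far-factor g * n) (radii-downFrom g) ⟩
        near-factor g * (length S * radius g) + far-factor g * n
          ≤⟨ +-monoˡ-≤ _ (*-monoʳ-≤ (near-factor g) small) ⟩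
        near-factor g * (c * n) + far-factor g * n
          ≡⟨ cong (_+ far-factor g * n) (*-assoc (near-factor g) c n) ⟨
        near-factor g * c * n + far-factor g * n
          ≡⟨ *-distribʳ-+ n (near-factor g * c) (far-factor g) ⟨
        hop-factor g c * n ∎
        where
        open ≤-Reasoning
        shuffle : ∀ s b t x → s * (b * t) * x ≡ b * (s * (t * x))
        shuffle = solve-∀

-- The spanner

∧-true⁻ : ∀ {a b} → a ∧ b ≡ true → a ≡ true × b ≡ true
∧-true⁻ {true} {true} _ = refl , refl

-- Each edge is assigned to the vertex that pays for its arc, which may be either end; hence the
-- factor 2.
numEdges-bound : ∀ {n x N} (H : Graph n) (Arc : Fin n → Fin n → Set) →
                 (∀ u v → adj H u v ≡ true → Arc u v ⊎ Arc v u) → (∀ v → AtMost (λ u → Arc u v) x N) →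
                 numEdges H * x ≤ 2 * (n * N)
numEdges-bound {n} {x} {N} H Arc arcs few =
  ≤-trans (AtMost-⊎ forward backward _
            (Unique.filter⁺ _ (Unique.cartesianProduct⁺ (Unique.allFin⁺ n) (Unique.allFin⁺ n)))
            (All.map (λ {p} → classify {p}) (All.all-filter _ (cartesianProduct (allFin n) (allFin n)))))
          (≤-reflexive (cong₂ _+_ total (trans total (sym (+-identityʳ _)))))
  where
  total : length (allFin n) * N ≡ n * N
  total = cong (_* N) (length-tabulate {n = n} (λ i → i))

  Into Outof : Fin n × Fin n → Set
  Into  p = ∃[ v ] (v ∈ allFin n × (proj₂ p ≡ v × Arc (proj₁ p) v))
  Outof p = ∃[ v ] (v ∈ allFin n × (proj₁ p ≡ v × Arc (proj₂ p) v))

  classify : ∀ {p} → (toℕ (proj₁ p) <ᵇ toℕ (proj₂ p)) ∧ adj H (proj₁ p) (proj₂ p) ≡ true → Into p ⊎ Outof p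
  classify {u , v} h with arcs u v (proj₂ (∧-true⁻ {toℕ u <ᵇ toℕ v} h))
  ... | inj₁ a = inj₁ (v , ∈-allFin v , refl , a)
  ... | inj₂ a = inj₂ (u , ∈-allFin u , refl , a)

  forward : AtMost Into x (length (allFin n) * N)
  forward = AtMost-⋃ (allFin n) λ v _ →
    AtMost-injection proj₁ (λ { (refl , _) (refl , _) refl → refl }) proj₂ (few v)

  backward : AtMost Outof x (length (allFin n) * N)
  backward = AtMost-⋃ (allFin n) λ v _ →
    AtMost-injection proj₂ (λ { (refl , _) (refl , _) refl → refl }) proj₂ (few v)

walk⇒path : ∀ {n} {A : Adjacency n} {s t ℓ} → Walk A s t ℓ → ∃[ xs ] (Path A s xs t × length xs ≡ ℓ)
walk⇒path here       = [] , [] , refl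
walk⇒path (step a w) = let xs , p , eq = walk⇒path w in _ ∷ xs , a ∷ p , cong suc eq

path⇒walk : ∀ {n} {A : Adjacency n} {s xs t} → Path A s xs t → Walk A s t (length xs)
path⇒walk []      = here
path⇒walk (a ∷ p) = step a (path⇒walk p)

module Construction (f : ℕ) {n : ℕ} (G : Graph n) (x : ℕ) (1≤x : 1 ≤ x) (fits : x ^ (2 ^ f) * x ≤ n) where

  open Weights n
  open Restoration G
  open import Data.List.Membership.DecPropositional (_≟_ {n}) using (_∈?_)
  open Greedy (adj G) (allFin n) (suc (suc f))

  Δ : ℕ
  Δ = x ^ (2 ^ f)

  -- Each chosen vertex meets at least `Δ` of the total demand (f + 2) * n, and a vertex left out
  -- has fewer than `Δ` open neighbours, at most n / `x` by `fits`.
  cluster = greedy 1 Δ (allFin n)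

  S : List (Fin n)
  S = proj₁ cluster

  S-unique : Unique S
  S-unique = Unique-resp-⊆ (proj₁ (proj₂ cluster)) (Unique.allFin⁺ n)

  S-small : length S * Δ ≤ suc (suc f) * n
  S-small = begin
    length S * Δ                      ≤⟨ m≤m+n _ _ ⟩
    length S * Δ + 1 * residue S      ≤⟨ proj₁ (proj₂ (proj₂ cluster)) ⟩
    1 * residue []                    ≡⟨ *-identityˡ _ ⟩
    residue []                        ≡⟨ residue-[] ⟩
    length (allFin n) * suc (suc f)   ≡⟨ cong (_* suc (suc f)) (length-tabulate {n = n} (λ i → i)) ⟩
    n * suc (suc f)                   ≡⟨ *-comm n _ ⟩
    suc (suc f) * n                   ∎
    where open ≤-Reasoning

  neighbours centres : Fin n → List (Fin n)
  neighbours v = filterTrue (λ s → adj G s v) S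
  centres v = take (suc (suc f)) (neighbours v)

  open module HopsAt (v : Fin n) = Hops G v x 1≤x using (HopWithin; Hop)

  -- The vertex `v` pays for the arc; each of the three kinds costs it O(n / x).
  data Arc (u v : Fin n) : Set where
    hop    : ∀ {s} → s ∈ S → HopWithin v f s u → Arc u v
    centre : u ∈ centres v → Arc u v
    light  : v ∉ S → adj G v u ∧ isOpen S u ≡ true → Arc u v

  -- Decidable because the first arc is unique: it suffices to compare `u` with that of any one
  -- minimal path.
  hop? : ∀ v F s u → Dec (Hop v F s u)
  hop? v F s u with ∃-list≤? any? n (λ ys → path? {A = adjMinus G F} v ys s)
  ... | no none = no λ { (xs , m) → none (u ∷ xs , min-length≤n m , proj₁ m) }
  ... | yes (_ , _ , p) with ∃-min p
  ...   | [] , m = no λ { (xs , m′) → case min-unique {xs = []} {u ∷ xs} m m′ of λ () }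
  ...   | u′ ∷ xs , m with u′ ≟ u
  ...     | yes refl = yes (xs , m)
  ...     | no  u′≢u = no λ { (_ , m′) → u′≢u (min-first m m′) }

  arc? : ∀ u v → Dec (Arc u v)
  arc? u v = map′ to from ((hops ⊎-dec (u ∈? centres v)) ⊎-dec
                           (¬? (v ∈? S) ×-dec ((adj G v u ∧ isOpen S u) Bool.≟ true)))
    where
    search-pair : ∀ {P : Fin n × Fin n → Set} → (∀ p → Dec (P p)) → Dec (∃ P)
    search-pair P? = map′ (λ (a , b , p) → (a , b) , p) (λ ((a , b) , p) → a , b , p)
                          (any? λ a → any? λ b → P? (a , b))
    hops : Dec (∃[ s ] (s ∈ S × HopWithin v f s u))
    hops = any? λ s → (s ∈? S) ×-dec ∃-list≤? search-pair f (λ F → hop? v F s u)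
    to : _ → Arc u v
    to (inj₁ (inj₁ (_ , s∈ , h))) = hop s∈ h
    to (inj₁ (inj₂ c))            = centre c
    to (inj₂ (v∉ , l))            = light v∉ l
    from : Arc u v → _
    from (hop s∈ h)   = inj₁ (inj₁ (_ , s∈ , h))
    from (centre c)   = inj₁ (inj₂ c)
    from (light v∉ l) = inj₂ (v∉ , l)

  chosen : Fin n → Fin n → Bool
  chosen u v = ⌊ arc? u v ⌋ ∨ ⌊ arc? v u ⌋

  chosen⁺ : ∀ {u v} → Arc u v ⊎ Arc v u → chosen u v ≡ true
  chosen⁺ {u} {v} h with arc? u v | arc? v u | h
  ... | yes _ | _     | _      = refl
  ... | no _  | yes _ | _      = refl
  ... | no ¬a | _     | inj₁ a = ⊥-elim (¬a a)
  ... | _     | no ¬a | inj₂ a = ⊥-elim (¬a a)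

  chosen⁻ : ∀ {u v} → chosen u v ≡ true → Arc u v ⊎ Arc v u
  chosen⁻ {u} {v} h with arc? u v | arc? v u
  ... | yes a | _     = inj₁ a
  ... | no _  | yes a = inj₂ a

  H : Graph n
  H = record
    { adj    = λ u v → adj G u v ∧ chosen u v
    ; sym    = λ u v → cong₂ _∧_ (Graph.sym G u v) (∨-comm ⌊ arc? u v ⌋ ⌊ arc? v u ⌋)
    ; irrefl = λ u → cong (_∧ chosen u u) (irrefl G u)
    }

  degree-factor : ℕ
  degree-factor = hop-factor f (suc (suc f)) + suc (suc f) + 1

  Arc-count : ∀ v → AtMost (λ u → Arc u v) x (degree-factor * n)
  Arc-count v = AtMost-≤ size (AtMost-⇒ cases (AtMost-⊎ (AtMost-⊎
      (Hops.hop-count G v x 1≤x f (suc (suc f)) S S-small)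
      (AtMost-scale x (AtMost-≤ few-centres (AtMost-∈ (centres v)))))
      light-count))
    where
    Light : Fin n → Set
    Light u = v ∉ S × adj G v u ∧ isOpen S u ≡ true

    cases : ∀ {u} → Arc u v → (∃[ s ] (s ∈ S × HopWithin v f s u) ⊎ u ∈ centres v) ⊎ Light u
    cases (hop s∈ h)   = inj₁ (inj₁ (_ , s∈ , h))
    cases (centre c)   = inj₁ (inj₂ c)
    cases (light v∉ l) = inj₂ (v∉ , l)

    few-centres : length (centres v) ≤ suc (suc f)
    few-centres = ≤-trans (≤-reflexive (length-take (suc (suc f)) (neighbours v))) (m⊓n≤m _ _)

    light-count : AtMost Light x n
    light-count []       _ _ = z≤n
    light-count us@(_ ∷ _) un ls@((v∉ , _) ∷ _) with proj₂ (proj₂ (proj₂ cluster)) v (∈-allFin v)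
    ... | inj₁ v∈ = ⊥-elim (v∉ v∈)
    ... | inj₂ l  = ≤-trans (*-monoˡ-≤ x (begin
        length us                                                        ≤⟨ Unique⇒length≤ un (λ {u} m → ∈-filter⁺ _ (∈-allFin u) (proj₂ (All.lookup ls m))) ⟩
        length (filterTrue (λ b → adj G v b ∧ isOpen S b) (allFin n))    ≡⟨ length-filterTrue _ (allFin n) ⟩
        load S v                                                         ≡⟨ *-identityˡ _ ⟨
        1 * load S v                                                     ≤⟨ <⇒≤ l ⟩
        Δ                                                                ∎)) fits
      where open ≤-Reasoning

    x≤n : x ≤ n
    x≤n = ≤-trans (m≤n*m x Δ {{m^n≢0 x (2 ^ f) {{>-nonZero 1≤x}}}}) fits

    size : hop-factor f (suc (suc f)) * n + suc (suc f) * x + n ≤ degree-factor * n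
    size = ≤-trans (+-monoˡ-≤ n (+-monoʳ-≤ (hop-factor f (suc (suc f)) * n) (*-monoʳ-≤ (suc (suc f)) x≤n)))
                   (≤-reflexive (shuffle (hop-factor f (suc (suc f))) (suc (suc f)) n))
      where
      shuffle : ∀ h c n → h * n + c * n + n ≡ (h + c + 1) * n
      shuffle = solve-∀

  numEdges-H : numEdges H * x ≤ 2 * (n * (degree-factor * n))
  numEdges-H = numEdges-bound H Arc (λ u v h → chosen⁻ (proj₂ (∧-true⁻ {adj G u v} h))) Arc-count

  -- Stretch under a fixed set of at most f + 1 faults

  module _ (F : FaultSet n) (F≤ : length F ≤ suc f) where

    G⁻ H⁻ : Adjacency n
    G⁻ = adjMinus G F
    H⁻ = adjMinus H F

    keep : ∀ {u v} → G⁻ u v ≡ true → Arc u v ⊎ Arc v u → H⁻ u v ≡ true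
    keep {u} {v} a arc with adjMinus⁻ G {F} a
    ... | a′ , free = adjMinus⁺ H {F} (cong₂ _∧_ a′ (chosen⁺ arc)) free

    G⁻-sym : ∀ {u v} → G⁻ u v ≡ true → G⁻ v u ≡ true
    G⁻-sym = adjMinus-sym G {F}

    H⁻-sym : ∀ {u v} → H⁻ u v ≡ true → H⁻ v u ≡ true
    H⁻-sym = adjMinus-sym H {F}

    H⁻⇒G⁻ : ∀ u v → H⁻ u v ≡ true → G⁻ u v ≡ true
    H⁻⇒G⁻ u v h with adjMinus⁻ H {F} h
    ... | a , free = adjMinus⁺ G {F} (proj₁ (∧-true⁻ {adj G u v} a)) free

    keep-min : ∀ {F′ v xs s} → s ∈ S → length F′ ≤ f → IsMin (adjMinus G F′) v xs s → Path G⁻ v xs s → Path H⁻ v xs s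
    keep-min s∈ l m []      = []
    keep-min {F′} s∈ l m (a ∷ p) = keep a (inj₂ (hop s∈ (F′ , l , _ , m))) ∷ keep-min {F′} s∈ l (min-tail m) p

    -- `restoration` gives up one fault, so both halves are minimal under at most `f` faults and
    -- consist of `hop` arcs.
    preserve : ∀ {s t xs} → s ∈ S → t ∈ S → Path G⁻ s xs t → ∃[ ys ] (Path H⁻ s ys t × length ys ≤ length xs)
    preserve {s} {t} {xs} s∈ t∈ p = go F refl
      where
      go : ∀ F′ → F ≡ F′ → ∃[ ys ] (Path H⁻ s ys t × length ys ≤ length xs)
      go [] refl with ∃-min p
      ... | ys , m = ys , keep-min {[]} t∈ z≤n m (proj₁ m) , min-length m p
      go (e ∷ F′) refl with restoration e F′ p
      ... | y , ys , zs , my , py , mz , pz , l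
          with path-reverse H⁻-sym (keep-min {F′} s∈ (s≤s⁻¹ F≤) my py)
      ...   | rs , q , eq = rs ++ zs , path-++ q (keep-min {F′} t∈ (s≤s⁻¹ F≤) mz pz) ,
              ≤-trans (≤-reflexive (trans (length-++ rs) (cong (_+ length zs) eq))) l

    hits-neighbours : ∀ v → hits S v ≡ length (neighbours v)
    hits-neighbours v = sym (length-filterTrue (λ s → adj G s v) S)

    -- If `v` is outside `S`, it pays for the edge as a light one. If `v` is in `S`, the open vertex
    -- `u` has so few neighbours there that `take` keeps them all, and `v` is a centre of `u`.
    keep-open : ∀ {u v} → isOpen S u ≡ true → G⁻ u v ≡ true → Arc u v ⊎ Arc v u
    keep-open {u} {v} o a with v ∈? S
    ... | no v∉  = inj₁ (light v∉ (cong₂ _∧_ (trans (Graph.sym G v u) (proj₁ (adjMinus⁻ G {F} a))) o))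
    ... | yes v∈ = inj₂ (centre (subst (v ∈_) (sym (take-all _ (neighbours u) few))
                                   (∈-filter⁺ _ v∈ (trans (Graph.sym G v u) (proj₁ (adjMinus⁻ G {F} a))))))
      where
      few : length (neighbours u) ≤ suc (suc f)
      few = subst (_≤ suc (suc f)) (hits-neighbours u) (<⇒≤ (<ᵇ⇒< _ _ (subst Bool.T (sym o) _)))

    -- A closed vertex has f + 2 distinct centres; losing all of them would take as many faults at
    -- `u`.
    surviving-centre : ∀ {u} → isOpen S u ≡ false → ∃[ c ] (c ∈ S × H⁻ u c ≡ true)
    surviving-centre {u} closed with Any.any? (λ c → inFaults F u c Bool.≟ false) (centres u)
    ... | yes some with find some
    ...   | c , c∈ , ok = c , proj₁ c∈S , keep (adjMinus⁺ G {F} (trans (Graph.sym G u c) (proj₂ c∈S)) free) (inj₂ (centre c∈))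
      where
      c∈S : c ∈ S × adj G c u ≡ true
      c∈S = ∈-filter⁻ _ (⊆-lookup (take-⊆ (suc (suc f)) (neighbours u)) c∈)
      free : Avoids G F u c
      free m l with trans (sym ok) (inFaults⁺ m l)
      ... | ()
    surviving-centre {u} closed | no none = ⊥-elim (<⇒≱ (s≤s F≤) (begin
      suc (suc f)            ≡⟨ m≤n⇒m⊓n≡m many ⟨
      suc (suc f) ⊓ length (neighbours u) ≡⟨ length-take _ (neighbours u) ⟨
      length (centres u)     ≤⟨ Unique⇒length≤ (Unique.take⁺ _ (Unique.filter⁺ _ S-unique)) faulty ⟩
      length (map other F)   ≡⟨ length-map other F ⟩
      length F               ∎))
      where
      open ≤-Reasoning
      many : suc (suc f) ≤ length (neighbours u)
      many = subst (suc (suc f) ≤_) (hits-neighbours u) (≮⇒≥ λ l → subst Bool.T closed (<⇒<ᵇ l))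

      other : Fin n × Fin n → Fin n
      other (a , b) with a ≟ u
      ... | yes _ = b
      ... | no  _ = a

      other-link : ∀ {e c} → Link e u c → other e ≡ c
      other-link {_} {c} (inj₁ refl) with u ≟ u
      ... | yes _ = refl
      ... | no ¬p = ⊥-elim (¬p refl)
      other-link {_} {c} (inj₂ refl) with c ≟ u
      ... | yes refl = refl
      ... | no _     = refl

      faulty : ∀ {c} → c ∈ centres u → c ∈ map other F
      faulty {c} m with inFaults⁻ F {u} {c} (¬-not λ eq → none (lose m eq))
      ... | e , e∈ , l = subst (_∈ map other F) (other-link l) (∈-map⁺ other e∈)

    -- Spans from the first to the last missing edge, so that the whole stretch is rerouted once and
    -- the error does not accumulate.
    Detour : Fin n → Fin n → ℕ → Set
    Detour s t ℓ = ∃[ u ] ∃[ w ] ∃[ as ] ∃[ bs ] ∃[ cs ] (Path H⁻ s as u × Path G⁻ u bs w × Path H⁻ w cs t ×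
                     length as + length bs + length cs ≡ ℓ × isOpen S u ≡ false × isOpen S w ≡ false)

    edge : ∀ {u v} → G⁻ u v ≡ true → H⁻ u v ≡ true ⊎ (isOpen S u ≡ false × isOpen S v ≡ false)
    edge {u} {v} a = by-cases (isOpen S u) (isOpen S v) refl refl
      where
      by-cases : ∀ o o′ → isOpen S u ≡ o → isOpen S v ≡ o′ →
                 H⁻ u v ≡ true ⊎ (isOpen S u ≡ false × isOpen S v ≡ false)
      by-cases true  _     ou _  = inj₁ (keep a (keep-open ou a))
      by-cases false true  _  ov = inj₁ (H⁻-sym (keep (G⁻-sym a) (keep-open ov (G⁻-sym a))))
      by-cases false false ou ov = inj₂ (ou , ov)

    decompose : ∀ {s xs t} → Path G⁻ s xs t → Path H⁻ s xs t ⊎ Detour s t (length xs)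
    decompose [] = inj₁ []
    decompose {s} {u ∷ xs} (a ∷ p) with edge a | decompose p
    ... | inj₁ h         | inj₁ q = inj₁ (h ∷ q)
    ... | inj₂ (os , ou) | inj₁ q = inj₂ (s , u , [] , u ∷ [] , xs , [] , a ∷ [] , q , refl , os , ou)
    ... | inj₁ h         | inj₂ (v , w , as , bs , cs , p₁ , p₂ , p₃ , eq , ov , ow) =
            inj₂ (v , w , u ∷ as , bs , cs , h ∷ p₁ , p₂ , p₃ , cong suc eq , ov , ow)
    ... | inj₂ (os , _)  | inj₂ (v , w , as , bs , cs , p₁ , p₂ , p₃ , eq , ov , ow) =
            inj₂ (s , w , [] , u ∷ as ++ bs , cs , [] , a ∷ path-++ (path-mono H⁻⇒G⁻ p₁) p₂ , p₃ ,
                  cong suc (trans (cong (_+ length cs) (length-++ as)) eq) , os , ow)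

    -- The 4 is two edges at each end: one from the closed vertex to its centre, and the same one
    -- back in the walk between centres whose length `preserve` keeps.
    spans : ∀ {s xs t} → Path G⁻ s xs t → ∃[ ys ] (Path H⁻ s ys t × length ys ≤ length xs + 4)
    spans {xs = xs} p with decompose p
    ... | inj₁ q = xs , q , m≤m+n _ 4
    ... | inj₂ (u , w , as , bs , cs , p₁ , p₂ , p₃ , eq , ou , ow)
        with surviving-centre ou | surviving-centre ow
    ...   | c , c∈ , uc | c′ , c′∈ , wc′
        with preserve c∈ c′∈ (H⁻⇒G⁻ _ _ (H⁻-sym uc) ∷ path-++ p₂ (H⁻⇒G⁻ _ _ wc′ ∷ []))
    ...     | ds , q , l = as ++ c ∷ ds ++ w ∷ cs , path-++ p₁ (uc ∷ path-++ q (H⁻-sym wc′ ∷ p₃)) , (begin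
        length (as ++ c ∷ ds ++ w ∷ cs)                        ≡⟨ trans (length-++ as) (cong (λ k → length as + suc k) (length-++ ds)) ⟩
        length as + suc (length ds + suc (length cs))          ≤⟨ +-monoʳ-≤ (length as) (s≤s (+-monoˡ-≤ _ l)) ⟩
        length as + suc (suc (length (bs ++ c′ ∷ [])) + suc (length cs))
          ≡⟨ cong (λ k → length as + suc (suc k + suc (length cs))) (length-++ bs) ⟩
        length as + suc (suc (length bs + 1) + suc (length cs)) ≡⟨ shuffle (length as) (length bs) (length cs) ⟩
        length as + length bs + length cs + 4                  ≡⟨ cong (_+ 4) eq ⟩
        length xs + 4                                          ∎)
      where
      open ≤-Reasoning
      shuffle : ∀ a b c → a + suc (suc (b + 1) + suc c) ≡ a + b + c + 4
      shuffle = solve-∀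

  isSpanner : FTAdditiveSpanner (suc f) 4 G H
  isSpanner = (λ u v h → proj₁ (∧-true⁻ {adj G u v} h)) , λ where
    F _ F≤ s t d (ℓ , ℓ≤d , w) →
      let xs , p , eq = walk⇒path w
          ys , q , l  = spans F F≤ p
      in length ys , ≤-trans l (+-monoˡ-≤ 4 (≤-trans (≤-reflexive eq) ℓ≤d)) , path⇒walk q

-- Choice of `x` and the exponent of the edge bound

integer-root : ∀ m n → 1 ≤ n → ∃[ x ] (1 ≤ x × x ^ suc m ≤ n × n < suc x ^ suc m)
integer-root m n 1≤n = search n (≤-trans (≤-reflexive (sym (*-identityʳ (suc n)))) (*-monoʳ-≤ (suc n) (m^n>0 (suc n) m)))
  where
  search : ∀ k → n < suc k ^ suc m → ∃[ x ] (1 ≤ x × x ^ suc m ≤ n × n < suc x ^ suc m)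
  search zero    n< = ⊥-elim (<⇒≱ n< (≤-trans (≤-reflexive (^-zeroˡ (suc m))) 1≤n))
  search (suc k) n< with suc k ^ suc m ≤? n
  ... | yes l = suc k , s≤s z≤n , l , n<
  ... | no ¬l = search k (≰⇒> ¬l)

^-distribʳ-* : ∀ a b m → (a * b) ^ m ≡ a ^ m * b ^ m
^-distribʳ-* a b zero    = refl
^-distribʳ-* a b (suc m) = trans (cong (a * b *_) (^-distribʳ-* a b m)) (shuffle a b (a ^ m) (b ^ m))
  where
  shuffle : ∀ a b c d → a * b * (c * d) ≡ a * c * (b * d)
  shuffle = solve-∀

-- The fractional exponent is cleared by raising to the power m = `suc q`. As n < (x + 1)^m and x +
-- 1 ≤ 2x, multiplying E^m by n gives at most (4kn^2)^m, and one factor n cancels, leaving n^(2m -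
-- 1).
edge-power-bound : ∀ q E x k n → 1 ≤ n → 1 ≤ x → n < suc x ^ suc q → E * x ≤ 2 * (n * (k * n)) →
                   E ^ suc q ≤ (4 * k) ^ suc q * n ^ (suc q + q)
edge-power-bound q E x k n 1≤n 1≤x n< Ex = *-cancelʳ-≤ _ _ n {{>-nonZero 1≤n}} (begin
  E ^ m * n                            ≤⟨ *-monoʳ-≤ (E ^ m) (<⇒≤ n<) ⟩
  E ^ m * suc x ^ m                    ≡⟨ ^-distribʳ-* E (suc x) m ⟨
  (E * suc x) ^ m                      ≤⟨ ^-monoˡ-≤ m product-bound ⟩
  (4 * k * (n * n)) ^ m                ≡⟨ ^-distribʳ-* (4 * k) (n * n) m ⟩
  (4 * k) ^ m * (n * n) ^ m            ≡⟨ cong ((4 * k) ^ m *_) (^-distribʳ-* n n m) ⟩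
  (4 * k) ^ m * (n ^ m * (n * n ^ q))  ≡⟨ shuffle ((4 * k) ^ m) (n ^ m) n (n ^ q) ⟩
  (4 * k) ^ m * (n ^ m * n ^ q) * n    ≡⟨ cong (λ y → (4 * k) ^ m * y * n) (^-distribˡ-+-* n m q) ⟨
  (4 * k) ^ m * n ^ (m + q) * n        ∎)
  where
  open ≤-Reasoning
  m = suc q
  shuffle : ∀ c p n r → c * (p * (n * r)) ≡ c * (p * r) * n
  shuffle = solve-∀
  product-bound : E * suc x ≤ 4 * k * (n * n)
  product-bound = begin
    E * suc x                 ≤⟨ *-monoʳ-≤ E (+-monoˡ-≤ x 1≤x) ⟩
    E * (x + x)               ≡⟨ *-distribˡ-+ E x x ⟩
    E * x + E * x             ≤⟨ +-mono-≤ Ex Ex ⟩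
    2 * (n * (k * n)) + 2 * (n * (k * n)) ≡⟨ shuffle′ n k ⟩
    4 * k * (n * n)           ∎
    where
    shuffle′ : ∀ n k → 2 * (n * (k * n)) + 2 * (n * (k * n)) ≡ 4 * k * (n * n)
    shuffle′ = solve-∀

spanner-factor : ℕ → ℕ
spanner-factor f = (4 * (hop-factor f (suc (suc f)) + suc (suc f) + 1)) ^ suc (2 ^ f)

theorem28 : ∀ (f : ℕ) → ∃[ C ] (∀ (n : ℕ) (G : Graph n) → ∃[ H ]
    (FTAdditiveSpanner (suc f) 4 G H ×
    numEdges H ^ (2 ^ f + 1) ≤ C * n ^ (2 ^ f + 1 + 2 ^ f)))
theorem28 f = spanner-factor f , spanner
  where
  spanner : ∀ n (G : Graph n) → ∃[ H ] (FTAdditiveSpanner (suc f) 4 G H ×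
              numEdges H ^ (2 ^ f + 1) ≤ spanner-factor f * n ^ (2 ^ f + 1 + 2 ^ f))
  -- For n = 0 no `x ≥ 1` satisfies x^m ≤ n, so `G` serves as its own spanner.
  spanner zero G = G , ((λ _ _ a → a) , λ _ _ _ ()) , subst (λ k → 0 ^ k ≤ spanner-factor f * 0 ^ (2 ^ f + 1 + 2 ^ f)) (+-comm 1 (2 ^ f)) z≤n
  spanner n@(suc _) G with integer-root (2 ^ f) n (s≤s z≤n)
  ... | x , 1≤x , x≤ , n< = H , isSpanner ,
        subst (λ k → numEdges H ^ k ≤ spanner-factor f * n ^ (k + 2 ^ f)) (+-comm 1 (2 ^ f))
          (edge-power-bound (2 ^ f) (numEdges H) x degree-factor n (s≤s z≤n) 1≤x n< numEdges-H)
    where open Construction f G x 1≤x (≤-trans (≤-reflexive (*-comm (x ^ (2 ^ f)) x)) x≤)
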